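{- Let $\alpha,\beta,c\in\mathbb{R}$ with $\beta<0$ and $c\neq 0$, and let $\{P_m(s)\}_{m=0}^{\infty}$ be the sequence of polynomials generated by $$\sum_{m=0}^{\infty}\frac{P_m(s)}{m!}z^m=e^{czs+\alpha z^2+\beta z^4}\qquad (s,z\in\mathbb{C}).$$ Then for every $m\ge 0$, every complex zero of $P_m$ is either real or purely imaginary.
   Context: The generating relation means that $P_m(s)/m!$ is the coefficient of $z^m$ in the power series expansion in $z$ of $e^{czs+\alpha z^2+\beta z^4}$; each $P_m$ is a polynomial in $s$. -}

module Defs where

open import Level using (0ℓ; suc)
open import Algebra.Core using (Op₁; Op₂)
open import Algebra.Bundles using (CommutativeRing; RawRing)
open import Algebra.Structures using (IsCommutativeRing)
import Algebra.Definitions.RawSemiring as RawSemiringDefinitions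
open import Data.Fin.Base using (toℕ)
open import Data.List.Base using (List; foldr)
open import Data.Nat.Base as ℕ using (ℕ; _∸_; _!)
open import Data.Product.Base using (∃-syntax; _×_)
open import Relation.Binary.Core using (Rel)
open import Relation.Binary.Structures using (IsStrictTotalOrder)
import Relation.Binary.Construct.StrictToNonStrict as StrictToNonStrict
open import Relation.Nullary.Negation.Core using (¬_)
open import Relation.Unary using (Pred; Satisfiable; _∈_)

-- The standard library has no real numbers.  They are characterised, uniquely
-- up to isomorphism in classical mathematics, as a complete ordered field.
record CompleteOrderedField : Set (suc 0ℓ) where
  infix  9 _⁻¹
  infix  8 -_
  infixl 7 _*_
  infixl 6 _+_
  infix  4 _≈_ _<_
  field
    ℝ   : Set
    _≈_ : Rel ℝ 0ℓ
    _<_ : Rel ℝ 0ℓ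
    _+_ : Op₂ ℝ
    _*_ : Op₂ ℝ
    -_  : Op₁ ℝ
    0#  : ℝ
    1#  : ℝ
    _⁻¹ : Op₁ ℝ

    isCommutativeRing : IsCommutativeRing _≈_ _+_ _*_ -_ 0# 1#
    1≉0               : ¬ (1# ≈ 0#)
    -- The value of 0# ⁻¹ is left unspecified.
    ⁻¹-inverseʳ       : ∀ x → ¬ (x ≈ 0#) → x * x ⁻¹ ≈ 1#

    isStrictTotalOrder : IsStrictTotalOrder _≈_ _<_
    +-monoˡ-<          : ∀ z {x y} → x < y → x + z < y + z
    *-pos              : ∀ {x y} → 0# < x → 0# < y → 0# < x * y

  open StrictToNonStrict _≈_ _<_ public using (_≤_)

  UpperBound : Pred ℝ 0ℓ → Pred ℝ 0ℓ
  UpperBound S u = ∀ {x} → x ∈ S → x ≤ u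

  -- "Least" is stated in the approximation form: every y < l is exceeded by an
  -- element of S.  Classically this says that no upper bound is below l.
  -- Together with the trichotomy of _<_, `complete` then decides every
  -- proposition A in Set (take S = {0} ∪ {1 | A}), so excluded middle is not
  -- assumed separately.
  IsSupremum : Pred ℝ 0ℓ → Pred ℝ 0ℓ
  IsSupremum S l =
    UpperBound S l × (∀ {y} → y < l → ∃[ x ] (x ∈ S × y < x))

  field
    complete : (S : Pred ℝ 0ℓ) → Satisfiable S → Satisfiable (UpperBound S) →
               Satisfiable (IsSupremum S)

  commutativeRing : CommutativeRing 0ℓ 0ℓ
  commutativeRing = record { isCommutativeRing = isCommutativeRing }

module Polynomials (A : RawRing 0ℓ 0ℓ) where
  open RawRing A

  -- Coefficients are listed from the constant term upwards.
  Polynomial : Set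
  Polynomial = List Carrier

  eval : Polynomial → Carrier → Carrier
  eval p s = foldr (λ a v → a + s * v) 0# p

module PowerSeries (A : RawRing 0ℓ 0ℓ) where
  open RawRing A
  open RawSemiringDefinitions rawSemiring using (sum)

  -- f n is the coefficient of zⁿ.
  Series : Set
  Series = ℕ → Carrier

  constant : Carrier → Series
  constant a ℕ.zero    = a
  constant a (ℕ.suc _) = 0#

  seriesRawRing : RawRing 0ℓ 0ℓ
  seriesRawRing = record
    { Carrier = Series
    ; _≈_     = λ f g → ∀ n → f n ≈ g n
    ; _+_     = λ f g n → f n + g n
    ; _*_     = λ f g n → sum {ℕ.suc n} λ i → f (toℕ i) * g (n ∸ toℕ i)
    ; -_      = λ f n → - f n
    ; 0#      = constant 0#
    ; 1#      = constant 1#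
    }

module Complex (𝓡 : CompleteOrderedField) where
  open CompleteOrderedField 𝓡
  open RawSemiringDefinitions
    (RawRing.rawSemiring (CommutativeRing.rawRing commutativeRing))
    using () renaming (_×_ to _·_)

  infix 4 _≈ᶜ_
  infix 5 _+i_

  record ℂ : Set where
    constructor _+i_
    field
      re : ℝ
      im : ℝ

  open ℂ public

  _≈ᶜ_ : Rel ℂ 0ℓ
  w ≈ᶜ z = re w ≈ re z × im w ≈ im z

  fromℝ : ℝ → ℂ
  fromℝ x = x +i 0#

  0ᶜ : ℂ
  0ᶜ = fromℝ 0#

  complexRawRing : RawRing 0ℓ 0ℓ
  complexRawRing = record
    { Carrier = ℂ
    ; _≈_     = _≈ᶜ_
    ; _+_     = λ w z → (re w + re z) +i (im w + im z)
    ; _*_     = λ w z → (re w * re z + - (im w * im z))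
                        +i (re w * im z + im w * re z)
    ; -_      = λ z → (- re z) +i (- im z)
    ; 0#      = 0ᶜ
    ; 1#      = fromℝ 1#
    }

  IsReal : Pred ℂ 0ℓ
  IsReal z = im z ≈ 0#

  IsPurelyImaginary : Pred ℂ 0ℓ
  IsPurelyImaginary z = re z ≈ 0#

  1/! : ℕ → ℂ
  1/! n = fromℝ (((n !) · 1#) ⁻¹)

  open Polynomials complexRawRing public
  open PowerSeries complexRawRing public
  open RawRing complexRawRing using () renaming (_*_ to _*ᶜ_)
  open RawSemiringDefinitions (RawRing.rawSemiring complexRawRing)
    using (sum)
  open RawSemiringDefinitions (RawRing.rawSemiring seriesRawRing)
    using () renaming (_^_ to _^ˢ_)

  -- exp f = Σₙ fⁿ / n!, for f without constant term.  As fⁿ then has no terms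
  -- of degree below n, only n ≤ m contribute to the coefficient of zᵐ.
  exp : Series → Series
  exp f m = sum {ℕ.suc m} λ n → 1/! (toℕ n) *ᶜ (f ^ˢ toℕ n) m

  -- c z s + α z² + β z⁴, as a series in z.
  exponent : (α β c : ℝ) → ℂ → Series
  exponent α β c s 1 = fromℝ c *ᶜ s
  exponent α β c s 2 = fromℝ α
  exponent α β c s 4 = fromℝ β
  exponent α β c s _ = 0ᶜ

  -- Σₘ (P m)(s) / m! zᵐ = exp (c z s + α z² + β z⁴) for all s.
  IsGeneratedBy : (α β c : ℝ) → (ℕ → Polynomial) → Set
  IsGeneratedBy α β c P =
    ∀ s m → 1/! m *ᶜ eval (P m) s ≈ᶜ exp (exponent α β c s) m

{-# OPTIONS --safe #-}

-- Put a = c s, t = a², and let E be the series exp (a z + α z² + β z⁴) with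
-- coefficients Eₘ.  Its even part is a limit of series ∏ᵢ (bᵢ + kᵢ t z²) · h with
-- bᵢ, kᵢ ≥ 0 real and h = exp (α z² + β z⁴), because
-- (1 + σ a z)^(2ⁿ) + (1 - σ a z)^(2ⁿ), σ = 2⁻ⁿ, splits into real factors
-- A² + 2 κ A B + B² with -1 < κ < 1; likewise for the odd part, where h has a
-- further factor z.  For such a product g put Wₘ(g) = Im (gₘ · conj gₘ₋₂).
-- Comparing coefficients in z g′ = ∑ᵢ 2 kᵢ t z² gⁱ + (2 α z² + 4 β z⁴) g, where
-- gⁱ is g with the i-th factor removed, gives
--   m Wₘ(g) = ∑ᵢ 2 (bᵢ kᵢ Im t |gⁱₘ₋₂|² + kᵢ² |t|² Wₘ₋₂(gⁱ)) - 4 β Wₘ₋₂(g)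
-- in the even case, and m - 1 in place of m in the odd case.  By induction
-- (Im t) Wₘ(g) ≥ 0, so that (Im t) (m Wₘ + 4 β Wₘ₋₂) ≥ 0 for g, and in the limit
-- also for the even part of E.  Since β < 0, this propagates (Im t) W₂ > 0 to all
-- even m ≥ 2, so Eₘ ≠ 0 whenever Im t ≠ 0, that is, off the axes.

module Submission where

open import Level using (0ℓ)
open import Defs
open import Algebra.Bundles using (CommutativeRing; RawRing)
open import Algebra.Structures using (IsCommutativeRing)
import Algebra.Definitions.RawSemiring as RawSemiringDefinitions
import Algebra.Properties.Ring as RingProperties
import Algebra.Properties.Semiring.Mult as SemiringMult
import Algebra.Properties.Semiring.Mult.TCOptimised as Multiples
import Algebra.Solver.Ring
open import Algebra.Solver.Ring.AlmostCommutativeRing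
  using (fromCommutativeRing; _-Raw-AlmostCommutative⟶_)
open import Data.Empty using (⊥; ⊥-elim)
open import Data.Fin.Base using (toℕ)
open import Data.Integer.Base as ℤ using (ℤ; -[1+_]; _⊖_) renaming (+_ to pos)
import Data.Integer.Properties as ℤ
open import Data.List.Base using (List; []; _∷_; _++_; map)
open import Data.List.Relation.Unary.All using (All; []; _∷_)
import Data.List.Relation.Unary.All.Properties as All
open import Data.Maybe.Base using (Maybe; just; nothing)
open import Data.Nat.Base as ℕ using (ℕ; zero; suc; _!; z≤n; s≤s)
open import Data.Nat.Induction using (<-rec)
import Data.Nat.Properties as ℕ
open import Data.Product.Base using (_×_; _,_; proj₁; proj₂; ∃-syntax)
open import Data.Sum.Base using (_⊎_; inj₁; inj₂)
open import Relation.Binary.Definitions using (tri<; tri≈; tri>)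
import Relation.Binary.PropositionalEquality as ≡
import Relation.Binary.Reasoning.Setoid as SetoidReasoning
open import Relation.Binary.Structures using (IsStrictTotalOrder)
open import Relation.Nullary.Decidable.Core using (yes; no)
open import Relation.Nullary.Negation.Core using (¬_)

module IntegerSolver {c ℓ} (R : CommutativeRing c ℓ) where
  open CommutativeRing R
  open RingProperties ring
    using (-‿distribˡ-*; -‿distribʳ-*; -‿involutive; -0#≈0#; -‿+-comm)
  open Multiples semiring using (×-homo-+; ×1-homo-*; 1+×) renaming (_×_ to _·_)
  open SetoidReasoning setoid

  private
    ⟦_⟧ : ℤ → Carrier
    ⟦ pos n    ⟧ = n · 1#
    ⟦ -[1+ n ] ⟧ = - (suc n · 1#)

    cancel : ∀ x y → x + - y ≈ (1# + x) + - (1# + y)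
    cancel x y = begin
      x + - y                      ≈⟨ +-congʳ (+-identityʳ x) ⟨
      (x + 0#) + - y               ≈⟨ +-congʳ (+-congˡ (-‿inverseʳ 1#)) ⟨
      (x + (1# + - 1#)) + - y      ≈⟨ +-congʳ (+-assoc x 1# (- 1#)) ⟨
      ((x + 1#) + - 1#) + - y      ≈⟨ +-assoc _ _ _ ⟩
      (x + 1#) + (- 1# + - y)      ≈⟨ +-cong (+-comm x 1#) (-‿+-comm 1# y) ⟩
      (1# + x) + - (1# + y)        ∎

    ⊖-homo : ∀ m n → ⟦ m ⊖ n ⟧ ≈ (m · 1#) + - (n · 1#)
    ⊖-homo zero    zero    = sym (-‿inverseʳ 0#)
    ⊖-homo zero    (suc n) = sym (+-identityˡ _)
    ⊖-homo (suc m) zero    = sym (trans (+-congˡ -0#≈0#) (+-identityʳ _))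
    ⊖-homo (suc m) (suc n) = begin
      ⟦ suc m ⊖ suc n ⟧                    ≡⟨ ≡.cong ⟦_⟧ (ℤ.[1+m]⊖[1+n]≡m⊖n m n) ⟩
      ⟦ m ⊖ n ⟧                            ≈⟨ ⊖-homo m n ⟩
      (m · 1#) + - (n · 1#)                ≈⟨ cancel _ _ ⟩
      (1# + m · 1#) + - (1# + n · 1#)      ≈⟨ +-cong (1+× m 1#) (-‿cong (1+× n 1#)) ⟨
      (suc m · 1#) + - (suc n · 1#)        ∎

    +-homo : ∀ i j → ⟦ i ℤ.+ j ⟧ ≈ ⟦ i ⟧ + ⟦ j ⟧
    +-homo (pos m)  (pos n)  = ×-homo-+ 1# m n
    +-homo (pos m)  -[1+ n ] = ⊖-homo m (suc n)
    +-homo -[1+ m ] (pos n)  = trans (⊖-homo n (suc m)) (+-comm _ _)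
    +-homo -[1+ m ] -[1+ n ] = begin
      - (suc (suc (m ℕ.+ n)) · 1#)         ≡⟨ ≡.cong (λ k → - (suc k · 1#)) (≡.sym (ℕ.+-suc m n)) ⟩
      - ((suc m ℕ.+ suc n) · 1#)           ≈⟨ -‿cong (×-homo-+ 1# (suc m) (suc n)) ⟩
      - (suc m · 1# + suc n · 1#)          ≈⟨ -‿+-comm _ _ ⟨
      - (suc m · 1#) + - (suc n · 1#)      ∎

    -‿homo : ∀ i → ⟦ ℤ.- i ⟧ ≈ - ⟦ i ⟧
    -‿homo (pos zero)    = sym -0#≈0#
    -‿homo (pos (suc n)) = refl
    -‿homo -[1+ n ]      = sym (-‿involutive _)

    *-homo-pos : ∀ m n → ⟦ pos m ℤ.* pos n ⟧ ≈ ⟦ pos m ⟧ * ⟦ pos n ⟧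
    *-homo-pos m n =
      trans (reflexive (≡.cong ⟦_⟧ (≡.sym (ℤ.pos-* m n)))) (×1-homo-* m n)

    *-homo-posˡ : ∀ m j → ⟦ pos m ℤ.* j ⟧ ≈ ⟦ pos m ⟧ * ⟦ j ⟧
    *-homo-posˡ m (pos n)  = *-homo-pos m n
    *-homo-posˡ m -[1+ n ] = begin
      ⟦ pos m ℤ.* -[1+ n ] ⟧               ≡⟨ ≡.cong ⟦_⟧ (ℤ.neg-distribʳ-* (pos m) (pos (suc n))) ⟨
      ⟦ ℤ.- (pos m ℤ.* pos (suc n)) ⟧      ≈⟨ -‿homo (pos m ℤ.* pos (suc n)) ⟩
      - ⟦ pos m ℤ.* pos (suc n) ⟧          ≈⟨ -‿cong (*-homo-pos m (suc n)) ⟩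
      - (⟦ pos m ⟧ * ⟦ pos (suc n) ⟧)      ≈⟨ -‿distribʳ-* _ _ ⟩
      ⟦ pos m ⟧ * - ⟦ pos (suc n) ⟧        ∎

    *-homo : ∀ i j → ⟦ i ℤ.* j ⟧ ≈ ⟦ i ⟧ * ⟦ j ⟧
    *-homo (pos m)  j = *-homo-posˡ m j
    *-homo -[1+ m ] j = begin
      ⟦ -[1+ m ] ℤ.* j ⟧                   ≡⟨ ≡.cong ⟦_⟧ (ℤ.neg-distribˡ-* (pos (suc m)) j) ⟨
      ⟦ ℤ.- (pos (suc m) ℤ.* j) ⟧          ≈⟨ -‿homo (pos (suc m) ℤ.* j) ⟩
      - ⟦ pos (suc m) ℤ.* j ⟧              ≈⟨ -‿cong (*-homo-posˡ (suc m) j) ⟩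
      - (⟦ pos (suc m) ⟧ * ⟦ j ⟧)          ≈⟨ -‿distribˡ-* _ _ ⟩
      - ⟦ pos (suc m) ⟧ * ⟦ j ⟧            ∎

    homomorphism : CommutativeRing.rawRing ℤ.+-*-commutativeRing
                   -Raw-AlmostCommutative⟶ fromCommutativeRing R
    homomorphism = record
      { ⟦_⟧    = ⟦_⟧
      ; +-homo = +-homo
      ; *-homo = *-homo
      ; -‿homo = -‿homo
      ; 0-homo = refl
      ; 1-homo = refl
      }

    _≟_ : ∀ i j → Maybe (⟦ i ⟧ ≈ ⟦ j ⟧)
    i ≟ j with i ℤ.≟ j
    ... | yes i≡j = just (reflexive (≡.cong ⟦_⟧ i≡j))
    ... | no  _   = nothing

  open Algebra.Solver.Ring _ _ homomorphism _≟_ public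
    using (Polynomial; con; solve; _:=_; _:+_; _:*_; _:-_; :-_)

  :0 :1 :2 : ∀ {n} → Polynomial n
  :0 = con (pos 0)
  :1 = con (pos 1)
  :2 = con (pos 2)

module SeriesRing (R : CommutativeRing 0ℓ 0ℓ) where
  open CommutativeRing R
  open RingProperties ring using (-0#≈0#)
  open PowerSeries rawRing public
  open RawSemiringDefinitions (RawRing.rawSemiring rawRing) using () renaming (_×_ to _·_)
  open SetoidReasoning setoid

  open RawRing seriesRawRing public using () renaming
    (_≈_ to _≈ˢ_; _+_ to _+ˢ_; _*_ to _*ˢ_; -_ to -ˢ_; 0# to 0ˢ; 1# to 1ˢ)

  nat : ℕ → Carrier
  nat n = n · 1#

  tail : Series → Series
  tail f n = f (suc n)

  shift : Series → Series
  shift f zero    = 0#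
  shift f (suc n) = f n

  shift-cong : ∀ {f g} → f ≈ˢ g → shift f ≈ˢ shift g
  shift-cong p zero    = refl
  shift-cong p (suc n) = p n

  *ˢ-cong-≤ : ∀ f {g g′} n → (∀ i → i ℕ.≤ n → g i ≈ g′ i) →
              (f *ˢ g) n ≈ (f *ˢ g′) n
  *ˢ-cong-≤ f zero    p = +-congʳ (*-congˡ (p 0 z≤n))
  *ˢ-cong-≤ f (suc n) p = +-cong (*-congˡ (p (suc n) ℕ.≤-refl))
    (*ˢ-cong-≤ (tail f) n (λ i i≤n → p i (ℕ.m≤n⇒m≤1+n i≤n)))

  *ˢ-congʳ : ∀ {f f′} g → f ≈ˢ f′ → f *ˢ g ≈ˢ f′ *ˢ g
  *ˢ-congʳ g p zero    = +-congʳ (*-congʳ (p 0))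
  *ˢ-congʳ g p (suc n) = +-cong (*-congʳ (p 0)) (*ˢ-congʳ g (λ i → p (suc i)) n)

  *ˢ-cong : ∀ {f f′ g g′} → f ≈ˢ f′ → g ≈ˢ g′ → f *ˢ g ≈ˢ f′ *ˢ g′
  *ˢ-cong {f′ = f′} {g} p q n =
    trans (*ˢ-congʳ g p n) (*ˢ-cong-≤ f′ n (λ i _ → q i))

  module _ where
    open IntegerSolver R

    *ˢ-distribʳ : ∀ h f g → (f +ˢ g) *ˢ h ≈ˢ (f *ˢ h) +ˢ (g *ˢ h)
    *ˢ-distribʳ h f g zero = solve 3 (λ h f g →
      (f :+ g) :* h :+ :0 := (f :* h :+ :0) :+ (g :* h :+ :0)) refl (h 0) (f 0) (g 0)
    *ˢ-distribʳ h f g (suc n) = trans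
      (+-congˡ (*ˢ-distribʳ h (tail f) (tail g) n))
      (solve 5 (λ h f g x y →
        (f :+ g) :* h :+ (x :+ y) := (f :* h :+ x) :+ (g :* h :+ y))
        refl (h (suc n)) (f 0) (g 0) _ _)

    scale-*ˢ : ∀ c f g n → ((λ i → c * f i) *ˢ g) n ≈ c * (f *ˢ g) n
    scale-*ˢ c f g zero = solve 3 (λ c x y →
      c :* x :* y :+ :0 := c :* (x :* y :+ :0)) refl c (f 0) (g 0)
    scale-*ˢ c f g (suc n) = trans (+-congˡ (scale-*ˢ c (tail f) g n))
      (solve 4 (λ c x y z → c :* x :* y :+ c :* z := c :* (x :* y :+ z))
        refl c (f 0) (g (suc n)) _)

    *ˢ-assoc : ∀ f g h → (f *ˢ g) *ˢ h ≈ˢ f *ˢ (g *ˢ h)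
    *ˢ-assoc f g h zero = solve 3 (λ x y z →
      (x :* y :+ :0) :* z :+ :0 := x :* (y :* z :+ :0) :+ :0) refl (f 0) (g 0) (h 0)
    *ˢ-assoc f g h (suc n) = begin
      (f 0 * g 0 + 0#) * h (suc n) + (tail (f *ˢ g) *ˢ h) n
        ≈⟨ +-congˡ (*ˢ-distribʳ h (λ i → f 0 * g (suc i)) (tail f *ˢ g) n) ⟩
      (f 0 * g 0 + 0#) * h (suc n)
        + (((λ i → f 0 * g (suc i)) *ˢ h) n + ((tail f *ˢ g) *ˢ h) n)
        ≈⟨ +-congˡ (+-cong (scale-*ˢ (f 0) (tail g) h n) (*ˢ-assoc (tail f) g h n)) ⟩
      (f 0 * g 0 + 0#) * h (suc n)
        + (f 0 * (tail g *ˢ h) n + (tail f *ˢ (g *ˢ h)) n)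
        ≈⟨ solve 5 (λ x y z u v →
             (x :* y :+ :0) :* z :+ (x :* u :+ v) := x :* (y :* z :+ u) :+ v)
             refl (f 0) (g 0) (h (suc n)) _ _ ⟩
      f 0 * (g 0 * h (suc n) + (tail g *ˢ h) n) + (tail f *ˢ (g *ˢ h)) n  ∎

    *ˢ-sucʳ : ∀ f g n → (f *ˢ g) (suc n) ≈ (f *ˢ tail g) n + f (suc n) * g 0
    *ˢ-sucʳ f g zero = solve 4 (λ a b c d →
      a :* b :+ (c :* d :+ :0) := (a :* b :+ :0) :+ c :* d)
      refl (f 0) (g 1) (f 1) (g 0)
    *ˢ-sucʳ f g (suc n) = trans (+-congˡ (*ˢ-sucʳ (tail f) g n)) (sym (+-assoc _ _ _))

    *ˢ-comm : ∀ f g → f *ˢ g ≈ˢ g *ˢ f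
    *ˢ-comm f g zero    = +-congʳ (*-comm _ _)
    *ˢ-comm f g (suc n) = begin
      f 0 * g (suc n) + (tail f *ˢ g) n   ≈⟨ +-cong (*-comm _ _) (*ˢ-comm (tail f) g n) ⟩
      g (suc n) * f 0 + (g *ˢ tail f) n   ≈⟨ +-comm _ _ ⟩
      (g *ˢ tail f) n + g (suc n) * f 0   ≈⟨ *ˢ-sucʳ g f n ⟨
      (g *ˢ f) (suc n)                    ∎

    constant-0 : ∀ n → constant 0# n ≈ 0#
    constant-0 zero    = refl
    constant-0 (suc n) = refl

    zero-*ˢ : ∀ {f} → (∀ n → f n ≈ 0#) → ∀ g n → (f *ˢ g) n ≈ 0#
    zero-*ˢ p g zero    = trans (+-identityʳ _) (trans (*-congʳ (p 0)) (zeroˡ _))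
    zero-*ˢ p g (suc n) = trans (+-cong (trans (*-congʳ (p 0)) (zeroˡ _))
      (zero-*ˢ (λ i → p (suc i)) g n)) (+-identityʳ _)

    constant-*ˢ : ∀ c f n → (constant c *ˢ f) n ≈ c * f n
    constant-*ˢ c f zero    = +-identityʳ _
    constant-*ˢ c f (suc n) =
      trans (+-congˡ (zero-*ˢ (λ _ → refl) f n)) (+-identityʳ _)

    *ˢ-identityˡ : ∀ f → 1ˢ *ˢ f ≈ˢ f
    *ˢ-identityˡ f n = trans (constant-*ˢ 1# f n) (*-identityˡ _)

    +ˢ-identityˡ : ∀ f → 0ˢ +ˢ f ≈ˢ f
    +ˢ-identityˡ f n = trans (+-congʳ (constant-0 n)) (+-identityˡ _)

    -ˢ‿inverseˡ : ∀ f → (-ˢ f) +ˢ f ≈ˢ 0ˢ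
    -ˢ‿inverseˡ f n = trans (-‿inverseˡ _) (sym (constant-0 n))

  isCommutativeRingˢ : IsCommutativeRing _≈ˢ_ _+ˢ_ _*ˢ_ -ˢ_ 0ˢ 1ˢ
  isCommutativeRingˢ = record
    { isRing = record
      { +-isAbelianGroup = record
        { isGroup = record
          { isMonoid = record
            { isSemigroup = record
              { isMagma = record
                { isEquivalence = record
                  { refl  = λ n → refl
                  ; sym   = λ p n → sym (p n)
                  ; trans = λ p q n → trans (p n) (q n)
                  }
                ; ∙-cong = λ p q n → +-cong (p n) (q n)
                }
              ; assoc = λ f g h n → +-assoc _ _ _
              }
            ; identity = +ˢ-identityˡ
                       , λ f n → trans (+-comm _ _) (+ˢ-identityˡ f n)
            }
          ; inverse = -ˢ‿inverseˡ
                    , λ f n → trans (+-comm _ _) (-ˢ‿inverseˡ f n)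
          ; ⁻¹-cong = λ p n → -‿cong (p n)
          }
        ; comm = λ f g n → +-comm _ _
        }
      ; *-cong     = *ˢ-cong
      ; *-assoc    = *ˢ-assoc
      ; *-identity = *ˢ-identityˡ
                   , λ f n → trans (*ˢ-comm f 1ˢ n) (*ˢ-identityˡ f n)
      ; distrib    = (λ f g h n → trans (*ˢ-comm f (g +ˢ h) n)
                       (trans (*ˢ-distribʳ f g h n)
                              (+-cong (*ˢ-comm g f n) (*ˢ-comm h f n))))
                   , *ˢ-distribʳ
      }
    ; *-comm = *ˢ-comm
    }

  seriesRing : CommutativeRing 0ℓ 0ℓ
  seriesRing = record { isCommutativeRing = isCommutativeRingˢ }

  module 𝓢 = CommutativeRing seriesRing

  constant-cong : ∀ {x y} → x ≈ y → constant x ≈ˢ constant y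
  constant-cong p zero    = p
  constant-cong p (suc n) = refl

  constant-+ : ∀ x y → constant (x + y) ≈ˢ constant x +ˢ constant y
  constant-+ x y zero    = refl
  constant-+ x y (suc n) = sym (+-identityˡ 0#)

  constant-neg : ∀ x → constant (- x) ≈ˢ -ˢ constant x
  constant-neg x zero    = refl
  constant-neg x (suc n) = sym -0#≈0#

  constant-* : ∀ x y → constant (x * y) ≈ˢ constant x *ˢ constant y
  constant-* x y zero    = sym (constant-*ˢ x (constant y) 0)
  constant-* x y (suc n) = sym (trans (constant-*ˢ x (constant y) (suc n)) (zeroʳ x))

  Z : Series
  Z zero          = 0#
  Z (suc zero)    = 1#
  Z (suc (suc _)) = 0#

  Z-*ˢ : ∀ f → Z *ˢ f ≈ˢ shift f
  Z-*ˢ f zero    = trans (+-identityʳ _) (zeroˡ _)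
  Z-*ˢ f (suc n) = trans (+-cong (zeroˡ _)
    (trans (*ˢ-congʳ f tail-Z n) (*ˢ-identityˡ f n))) (+-identityˡ _)
    where
    tail-Z : tail Z ≈ˢ 1ˢ
    tail-Z zero    = refl
    tail-Z (suc _) = refl

  module _ where
    open IntegerSolver R

    -- The derivation z d/dz.
    θ : Series → Series
    θ f n = nat n * f n

    θ-cong : ∀ {f g} → f ≈ˢ g → θ f ≈ˢ θ g
    θ-cong p n = *-congˡ (p n)

    θ-+ : ∀ f g → θ (f +ˢ g) ≈ˢ θ f +ˢ θ g
    θ-+ f g n = distribˡ _ _ _

    θ-* : ∀ f g → θ (f *ˢ g) ≈ˢ (θ f *ˢ g) +ˢ (f *ˢ θ g)
    θ-* f g zero = solve 2 (λ x y →
      :0 :* (x :* y :+ :0) := (:0 :* x :* y :+ :0) :+ (x :* (:0 :* y) :+ :0))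
      refl (f 0) (g 0)
    θ-* f g (suc n) = begin
      (1# + N) * (f 0 * g (suc n) + F)
        ≈⟨ solve 4 (λ N x y F → (:1 :+ N) :* (x :* y :+ F)
             := x :* ((:1 :+ N) :* y) :+ (F :+ N :* F)) refl N (f 0) (g (suc n)) F ⟩
      f 0 * ((1# + N) * g (suc n)) + (F + N * F)
        ≈⟨ +-congˡ (+-congˡ (θ-* (tail f) g n)) ⟩
      f 0 * ((1# + N) * g (suc n)) + (F + ((θ (tail f) *ˢ g) n + G))
        ≈⟨ solve 6 (λ x y F H G u → x :+ (F :+ (H :+ G))
             := (:0 :* u :* y :+ (F :+ H)) :+ (x :+ G))
             refl (f 0 * ((1# + N) * g (suc n))) (g (suc n)) F _ G (f 0) ⟩
      (0# * f 0 * g (suc n) + (F + (θ (tail f) *ˢ g) n)) + (f 0 * ((1# + N) * g (suc n)) + G)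
        ≈⟨ +-congʳ (+-congˡ (*ˢ-distribʳ g (tail f) (θ (tail f)) n)) ⟨
      (0# * f 0 * g (suc n) + ((tail f +ˢ θ (tail f)) *ˢ g) n) + (f 0 * ((1# + N) * g (suc n)) + G)
        ≈⟨ +-congʳ (+-congˡ (*ˢ-congʳ {tail f +ˢ θ (tail f)} {tail (θ f)} g (λ i →
             trans (+-congʳ (sym (*-identityˡ _))) (sym (distribʳ _ _ _))) n)) ⟩
      (0# * f 0 * g (suc n) + (tail (θ f) *ˢ g) n) + (f 0 * ((1# + N) * g (suc n)) + G) ∎
      where
      N = nat n
      F = (tail f *ˢ g) n
      G = (tail f *ˢ θ g) n

    θ-constant : ∀ c → θ (constant c) ≈ˢ 0ˢ
    θ-constant c zero    = zeroˡ c
    θ-constant c (suc n) = zeroʳ _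

    θ-Z : θ Z ≈ˢ Z
    θ-Z zero          = zeroˡ _
    θ-Z (suc zero)    = trans (*-identityʳ _) (+-identityʳ _)
    θ-Z (suc (suc n)) = zeroʳ _

module PowersOfTwo {c ℓ} (S : CommutativeRing c ℓ) where
  open CommutativeRing S
  open IntegerSolver S

  -- pow2 n x = x ^ 2ⁿ and pow2-1 n x = x ^ (2ⁿ - 1).
  pow2 pow2-1 : ℕ → Carrier → Carrier
  pow2 zero    x = x
  pow2 (suc n) x = pow2 n (x * x)
  pow2-1 zero    x = 1#
  pow2-1 (suc n) x = x * pow2-1 n (x * x)

  2^ : ℕ → Carrier
  2^ zero    = 1#
  2^ (suc n) = (1# + 1#) * 2^ n

  pow2-square : ∀ n x → pow2 (suc n) x ≈ pow2 n x * pow2 n x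
  pow2-square zero    x = refl
  pow2-square (suc n) x = pow2-square n (x * x)

  *-pow2-1 : ∀ n x → x * pow2-1 n x ≈ pow2 n x
  *-pow2-1 zero    x = *-identityʳ x
  *-pow2-1 (suc n) x = trans (sym (*-assoc x x _)) (*-pow2-1 n (x * x))

  quad : Carrier → Carrier → Carrier → Carrier
  quad κ a b = a * a + b * b + (1# + 1#) * (κ * (a * b))

  quadProduct : List Carrier → Carrier → Carrier → Carrier
  quadProduct []      a b = 1#
  quadProduct (κ ∷ K) a b = quad κ a b * quadProduct K a b

  -- With κ = cos φ, μ = sin (φ/2) and ν = - μ.
  quad-split : ∀ {κ μ ν} → κ ≈ 1# + - ((1# + 1#) * (μ * μ)) → ν ≈ - μ →
               ∀ a b → quad κ (a * a) (b * b) ≈ quad μ a b * quad ν a b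
  quad-split {μ = μ} p q a b = trans (+-congˡ (*-congˡ (*-congʳ p)))
    (trans (solve 3 (λ m a b →
      a :* a :* (a :* a) :+ b :* b :* (b :* b)
        :+ :2 :* ((:1 :+ :- (:2 :* (m :* m))) :* (a :* a :* (b :* b)))
      := (a :* a :+ b :* b :+ :2 :* (m :* (a :* b)))
         :* (a :* a :+ b :* b :+ :2 :* (:- m :* (a :* b))))
      refl μ a b)
    (*-congˡ (+-congˡ (*-congˡ (*-congʳ (sym q))))))

  quad-zero : ∀ {κ} → κ ≈ 0# → ∀ a b → a * a + b * b ≈ quad κ a b
  quad-zero p a b = trans
    (solve 2 (λ a b → a :* a :+ b :* b := a :* a :+ b :* b :+ :2 :* (:0 :* (a :* b))) refl a b)
    (+-congˡ (*-congˡ (*-congʳ (sym p))))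

  quad-1± : ∀ {x s y b k} κ → x * x ≈ s * y → b ≈ (1# + 1#) * (1# + κ) →
            k ≈ (1# + 1#) * (1# + - κ) * s →
            quad κ (1# + x) (1# + - x) ≈ b + k * y
  quad-1± {x} {s} {y} κ p q r = trans
    (solve 2 (λ κ x →
      (:1 :+ x) :* (:1 :+ x) :+ (:1 :+ :- x) :* (:1 :+ :- x)
        :+ :2 :* (κ :* ((:1 :+ x) :* (:1 :+ :- x)))
      := :2 :* (:1 :+ κ) :+ :2 :* (:1 :+ :- κ) :* (x :* x)) refl κ x)
    (+-cong (sym q) (trans (*-congˡ p) (trans (sym (*-assoc _ s y)) (*-congʳ (sym r)))))

  sum-1± : ∀ {b k} x y → b ≈ 1# + 1# → k ≈ 0# →
           (1# + x) + (1# + - x) ≈ (b + k * y) * 1#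
  sum-1± x y p q = trans
    (solve 2 (λ x y → (:1 :+ x) :+ (:1 :+ :- x) := (:2 :+ :0 :* y) :* :1) refl x y)
    (*-congʳ (+-cong (sym p) (*-congʳ (sym q))))

  difference-1± : ∀ x → (1# + x) + - (1# + - x) ≈ (x + x) * 1#
  difference-1± = solve 1 (λ x → (:1 :+ x) :+ :- (:1 :+ :- x) := (x :+ x) :* :1) refl

  pow2-1+-* : ∀ n x e → pow2 n (1# + x) * e
              ≈ pow2-1 n (1# + x) * e + x * (pow2-1 n (1# + x) * e)
  pow2-1+-* n x e = trans (*-congʳ (sym (*-pow2-1 n (1# + x))))
    (solve 3 (λ x d e → ((:1 :+ x) :* d) :* e := d :* e :+ x :* (d :* e)) refl x _ e)

  distrib-swap : ∀ x y z → (x * y) * z ≈ y * (x * z)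
  distrib-swap = solve 3 (λ x y z → (x :* y) :* z := y :* (x :* z)) refl

  pow2-difference : ∀ n a b →
    pow2 (suc n) a + - pow2 (suc n) b
    ≈ (pow2 n a + - pow2 n b) * (pow2 n a + pow2 n b)
  pow2-difference n a b = trans
    (+-cong (pow2-square n a) (-‿cong (pow2-square n b)))
    (solve 2 (λ x y → x :* x :+ :- (y :* y) := (x :+ :- y) :* (x :+ y)) refl _ _)

module Differential {c ℓ} (S : CommutativeRing c ℓ) where
  open CommutativeRing S
  open IntegerSolver S
  open PowersOfTwo S
  open RawSemiringDefinitions (RawRing.rawSemiring rawRing)
    using (_^_) renaming (_×_ to _·_)

  module Derivation
    (θ      : Carrier → Carrier)
    (θ-cong : ∀ {x y} → x ≈ y → θ x ≈ θ y)
    (θ-+    : ∀ x y → θ (x + y) ≈ θ x + θ y)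
    (θ-*    : ∀ x y → θ (x * y) ≈ θ x * y + x * θ y) where

    nat : ℕ → Carrier
    nat n = n · 1#

    θ-1 : θ 1# ≈ 0#
    θ-1 = trans (solve 1 (λ t → t := (t :* :1 :+ :1 :* t) :+ :- t) refl (θ 1#))
      (trans (+-congʳ (sym (θ-* 1# 1#)))
      (trans (+-congʳ (θ-cong (*-identityʳ 1#))) (-‿inverseʳ _)))

    θ-constant-* : ∀ {a} → θ a ≈ 0# → ∀ x → θ (a * x) ≈ a * θ x
    θ-constant-* p x = trans (θ-* _ x) (trans (+-congʳ (trans (*-congʳ p) (zeroˡ x))) (+-identityˡ _))

    θ-square : ∀ {x} → θ x ≈ x → θ (x * x) ≈ (1# + 1#) * (x * x)
    θ-square {x} p = trans (θ-* x x) (trans (+-cong (*-congʳ p) (*-congˡ p))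
      (solve 1 (λ z → z :+ z := :2 :* z) refl (x * x)))

    θ-constant-*-double : ∀ {a x} → θ a ≈ 0# → θ x ≈ (1# + 1#) * x →
                          θ (a * x) ≈ (1# + 1#) * (a * x)
    θ-constant-*-double {a} {x} p q = trans (θ-constant-* p x) (trans (*-congˡ q)
      (solve 2 (λ a x → a :* (:2 :* x) := :2 :* (a :* x)) refl a x))

    θ-quartic : ∀ {a u v z} → θ a ≈ 0# → θ u ≈ 0# → θ v ≈ 0# → θ z ≈ z →
      θ (a * z + (u * (z * z) + v * ((z * z) * (z * z))))
      ≈ a * z + ((u + u) * (z * z) + ((v + v) + (v + v)) * ((z * z) * (z * z)))
    θ-quartic {a} {u} {v} {z} p q r s = trans (θ-+ _ _) (+-cong
      (trans (θ-constant-* p z) (*-congˡ s))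
      (trans (θ-+ _ _) (+-cong
        (trans (θ-constant-* q (z * z)) (trans (*-congˡ (θ-square s))
          (solve 2 (λ u w → u :* (:2 :* w) := (u :+ u) :* w) refl u (z * z))))
        (trans (θ-constant-* r ((z * z) * (z * z)))
          (trans (*-congˡ (trans (θ-* (z * z) (z * z))
            (+-cong (*-congʳ (θ-square s)) (*-congˡ (θ-square s)))))
          (solve 2 (λ v w → v :* (:2 :* w :* w :+ w :* (:2 :* w)) := ((v :+ v) :+ (v :+ v)) :* (w :* w))
            refl v (z * z)))))))

    θ-*-eigen : ∀ {e h} → θ h ≈ e * h → ∀ x → θ (x * h) ≈ θ x * h + e * (x * h)
    θ-*-eigen {e} {h} p x = trans (θ-* x h) (+-congˡ (trans (*-congˡ p)
      (solve 3 (λ x e h → x :* (e :* h) := e :* (x :* h)) refl x e h)))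

    θ-pow2 : ∀ n x → θ (pow2 n x) ≈ 2^ n * (pow2-1 n x * θ x)
    θ-pow2 zero    x = solve 1 (λ x → x := :1 :* (:1 :* x)) refl (θ x)
    θ-pow2 (suc n) x = trans (θ-pow2 n (x * x))
      (trans (*-congˡ (*-congˡ (θ-* x x)))
      (solve 4 (λ c p x y → c :* (p :* (y :* x :+ x :* y))
                   := (:2 :* c) :* ((x :* p) :* y)) refl _ _ x (θ x)))

    θ-pow2-eigen : ∀ n {x u w e l} → θ x ≈ u → 2^ n * u ≈ w → θ e ≈ l * e →
      θ (pow2 n x * e) ≈ w * (pow2-1 n x * e) + l * (pow2 n x * e)
    θ-pow2-eigen n {x} {u} {w} {e} {l} p q r = trans (θ-*-eigen r (pow2 n x)) (+-congʳ
      (trans (*-congʳ (trans (θ-pow2 n x) (*-congˡ (*-congˡ p))))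
      (trans (solve 4 (λ c d u e → (c :* (d :* u)) :* e := (c :* u) :* (d :* e)) refl
        (2^ n) (pow2-1 n x) u e) (*-congʳ q))))

    θ-1+ : ∀ {x} → θ x ≈ x → θ (1# + x) ≈ x
    θ-1+ {x} p = trans (θ-+ 1# x) (trans (+-cong θ-1 p) (+-identityˡ x))

    θ-double-eigen : ∀ {x e l} → θ x ≈ x → θ e ≈ l * e →
                     θ ((x + x) * e) ≈ (1# + l) * ((x + x) * e)
    θ-double-eigen {x} {e} {l} p q = trans (θ-*-eigen q (x + x))
      (trans (+-congʳ (*-congʳ (trans (θ-+ x x) (+-cong p p))))
      (solve 3 (λ x e l → (x :+ x) :* e :+ l :* ((x :+ x) :* e) := (:1 :+ l) :* ((x :+ x) :* e))
        refl x e l))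

    θ-^ : ∀ n x → θ (x ^ suc n) ≈ nat (suc n) * (x ^ n * θ x)
    θ-^ zero    x = trans (θ-cong (*-identityʳ x))
      (solve 1 (λ y → y := (:1 :+ :0) :* (:1 :* y)) refl (θ x))
    θ-^ (suc n) x = trans (θ-* x (x ^ suc n)) (trans (+-congˡ (*-congˡ (θ-^ n x)))
      (solve 4 (λ x p y k → y :* (x :* p) :+ x :* (k :* (p :* y))
                            := (:1 :+ k) :* (x :* p :* y))
         refl x (x ^ n) (θ x) (nat (suc n))))

    module PartialExponentials
      (i : ℕ → Carrier) (θ-i : ∀ n → θ (i n) ≈ 0#)
      (i-suc : ∀ n → nat (suc n) * i (suc n) ≈ i n) (x : Carrier) where

      partialExp : ℕ → Carrier
      partialExp zero    = 0#
      partialExp (suc M) = partialExp M + i M * x ^ M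

      θ-partialExp : ∀ M → θ (partialExp (suc M)) ≈ θ x * partialExp M
      θ-partialExp zero = trans (θ-cong (+-identityˡ _))
        (trans (θ-constant-* (θ-i 0) 1#)
        (trans (*-congˡ θ-1) (trans (zeroʳ _) (sym (zeroʳ _)))))
      θ-partialExp (suc M) = trans (θ-+ _ _)
        (trans (+-cong (θ-partialExp M) (trans (θ-constant-* (θ-i (suc M)) _) (*-congˡ (θ-^ M x))))
        (trans (solve 5 (λ y e j n p → y :* e :+ j :* (n :* (p :* y)) := y :* (e :+ (n :* j) :* p))
           refl (θ x) (partialExp M) (i (suc M)) (nat (suc M)) (x ^ M))
        (*-congˡ (+-congˡ (*-congʳ (i-suc M))))))

    module LinearFactors {C : Set} (ι : C → Carrier) (θ-ι : ∀ c → θ (ι c) ≈ 0#)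
      (y : Carrier) (θ-y : θ y ≈ (1# + 1#) * y) where

      factor : C × C → Carrier
      factor (b , k) = ι b + ι k * y

      product θproduct : List (C × C) → Carrier
      product []      = 1#
      product (f ∷ l) = factor f * product l
      θproduct []      = 0#
      θproduct ((b , k) ∷ l) =
        (1# + 1#) * (ι k * y) * product l + factor (b , k) * θproduct l

      product-++ : ∀ l m → product (l ++ m) ≈ product l * product m
      product-++ []      m = sym (*-identityˡ _)
      product-++ (f ∷ l) m = trans (*-congˡ (product-++ l m)) (sym (*-assoc _ _ _))

      θ-product : ∀ l → θ (product l) ≈ θproduct l
      θ-product []            = θ-1
      θ-product ((b , k) ∷ l) = trans (θ-* _ _) (+-cong
        (*-congʳ (trans (θ-+ _ _)
          (trans (+-cong (θ-ι b) (trans (θ-constant-* (θ-ι k) y) (*-congˡ θ-y)))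
            (solve 2 (λ k y → :0 :+ k :* (:2 :* y) := :2 :* (k :* y)) refl (ι k) y))))
        (*-congˡ (θ-product l)))

      factor-expand : ∀ b k p q h → (p * (factor (b , k) * q)) * h
                      ≈ ι b * ((p * q) * h) + ι k * (y * ((p * q) * h))
      factor-expand b k = solve 6 (λ b k y p q h →
        (p :* ((b :+ k :* y) :* q)) :* h
        := b :* ((p :* q) :* h) :+ k :* (y :* ((p :* q) :* h))) refl (ι b) (ι k) y

      factor-move : ∀ f p q h → (p * (factor f * q)) * h ≈ ((factor f * p) * q) * h
      factor-move f = solve 4 (λ f p q h →
        (p :* (f :* q)) :* h := ((f :* p) :* q) :* h) refl (factor f)

      θproduct-∷ : ∀ b k l p h → (p * θproduct ((b , k) ∷ l)) * h
                   ≈ (ι k * (y * ((p * product l) * h)) + ι k * (y * ((p * product l) * h)))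
                     + ((factor (b , k) * p) * θproduct l) * h
      θproduct-∷ b k l p h = solve 7 (λ b k y p q d h →
        (p :* (:2 :* (k :* y) :* q :+ (b :+ k :* y) :* d)) :* h
        := (k :* (y :* ((p :* q) :* h)) :+ k :* (y :* ((p :* q) :* h)))
           :+ (((b :+ k :* y) :* p) :* d) :* h) refl (ι b) (ι k) y p (product l) (θproduct l) h

module OrderedField (𝓡 : CompleteOrderedField) where
  open CompleteOrderedField 𝓡
    hiding (_≈_; _+_; _*_; -_; 0#; 1#; isCommutativeRing)
  open CommutativeRing commutativeRing hiding (Carrier)
  open IntegerSolver commutativeRing
  open PowersOfTwo commutativeRing using (2^)
  open IsStrictTotalOrder isStrictTotalOrder
    using (compare; <-respʳ-≈; <-respˡ-≈; irrefl) renaming (trans to <-trans)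
  open RawSemiringDefinitions (RawRing.rawSemiring rawRing)
    using () renaming (_×_ to _·_)

  <⇒0<- : ∀ {x y} → x < y → 0# < y + - x
  <⇒0<- {x} p = <-respˡ-≈ (-‿inverseʳ x) (+-monoˡ-< (- x) p)

  0<-⇒< : ∀ {x y} → 0# < y + - x → x < y
  0<-⇒< {x} {y} p = <-respʳ-≈ (solve 2 (λ x y → y :+ :- x :+ x := y) refl x y)
    (<-respˡ-≈ (+-identityˡ x) (+-monoˡ-< x p))

  ≤⇒0≤- : ∀ {x y} → x ≤ y → 0# ≤ y + - x
  ≤⇒0≤- (inj₁ p)     = inj₁ (<⇒0<- p)
  ≤⇒0≤- {x} (inj₂ p) = inj₂ (sym (trans (+-congʳ (sym p)) (-‿inverseʳ x)))

  0≤-⇒≤ : ∀ {x y} → 0# ≤ y + - x → x ≤ y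
  0≤-⇒≤ (inj₁ p) = inj₁ (0<-⇒< p)
  0≤-⇒≤ {x} {y} (inj₂ p) = inj₂ (trans (sym (+-identityˡ x))
    (trans (+-congʳ p) (solve 2 (λ x y → y :+ :- x :+ x := y) refl x y)))

  0≤-resp : ∀ {x y} → x ≈ y → 0# ≤ x → 0# ≤ y
  0≤-resp p (inj₁ q) = inj₁ (<-respʳ-≈ p q)
  0≤-resp p (inj₂ q) = inj₂ (trans q p)

  0<+0< : ∀ {x y} → 0# < x → 0# < y → 0# < x + y
  0<+0< {x} {y} p q =
    <-trans q (<-respˡ-≈ (+-identityˡ y) (+-monoˡ-< y p))

  0<+0≤ : ∀ {x y} → 0# < x → 0# ≤ y → 0# < x + y
  0<+0≤ p (inj₁ q) = 0<+0< p q
  0<+0≤ p (inj₂ q) = <-respʳ-≈ (trans (sym (+-identityʳ _)) (+-congˡ q)) p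

  0≤+0≤ : ∀ {x y} → 0# ≤ x → 0# ≤ y → 0# ≤ x + y
  0≤+0≤ (inj₁ p) q = inj₁ (0<+0≤ p q)
  0≤+0≤ (inj₂ p) q = 0≤-resp (trans (sym (+-identityˡ _)) (+-congʳ p)) q

  0≤*0≤ : ∀ {x y} → 0# ≤ x → 0# ≤ y → 0# ≤ x * y
  0≤*0≤ (inj₁ p) (inj₁ q) = inj₁ (*-pos p q)
  0≤*0≤ (inj₂ p) _        = inj₂ (sym (trans (*-congʳ (sym p)) (zeroˡ _)))
  0≤*0≤ (inj₁ _) (inj₂ q) = inj₂ (sym (trans (*-congˡ (sym q)) (zeroʳ _)))

  <0⇒0<- : ∀ {x} → x < 0# → 0# < - x
  <0⇒0<- p = <-respʳ-≈ (+-identityˡ _) (<⇒0<- p)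

  0<-⇒<0 : ∀ {x} → 0# < - x → x < 0#
  0<-⇒<0 p = 0<-⇒< (<-respʳ-≈ (sym (+-identityˡ _)) p)

  0≤⇒≮0 : ∀ {x} → 0# ≤ x → ¬ (x < 0#)
  0≤⇒≮0 (inj₁ p) q = irrefl refl (<-trans p q)
  0≤⇒≮0 (inj₂ p) q = irrefl (sym p) q

  ≮0⇒0≤ : ∀ {x} → ¬ (x < 0#) → 0# ≤ x
  ≮0⇒0≤ {x} p with compare 0# x
  ... | tri< q _ _ = inj₁ q
  ... | tri≈ _ q _ = inj₂ q
  ... | tri> _ _ q = ⊥-elim (p q)

  ≤⇒≯ : ∀ {x y} → x ≤ y → ¬ (y < x)
  ≤⇒≯ (inj₁ p) q = irrefl refl (<-trans p q)
  ≤⇒≯ (inj₂ p) q = irrefl (sym p) q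

  x<x+0< : ∀ {x y} → 0# < y → x < x + y
  x<x+0< {x} {y} p = 0<-⇒< (<-respʳ-≈ (solve 2 (λ x y → y := x :+ y :+ :- x) refl x y) p)

  square-pos : ∀ {x} → ¬ (x ≈ 0#) → 0# < x * x
  square-pos {x} x≉0 with compare x 0#
  ... | tri< p _ _ = <-respʳ-≈ (solve 1 (λ x → (:- x) :* (:- x) := x :* x) refl x)
                       (*-pos (<0⇒0<- p) (<0⇒0<- p))
  ... | tri≈ _ p _ = ⊥-elim (x≉0 p)
  ... | tri> _ _ p = *-pos p p

  0≤square : ∀ x → 0# ≤ x * x
  0≤square x with compare x 0#
  ... | tri< _ p _ = inj₁ (square-pos p)
  ... | tri≈ _ p _ = inj₂ (sym (trans (*-congʳ p) (zeroˡ x)))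
  ... | tri> _ p _ = inj₁ (square-pos p)

  0<1 : 0# < 1#
  0<1 = <-respʳ-≈ (*-identityˡ 1#) (square-pos 1≉0)

  0<⇒≉0 : ∀ {x} → 0# < x → ¬ (x ≈ 0#)
  0<⇒≉0 p q = irrefl (sym q) p

  0<-cancelˡ : ∀ {x y} → 0# < x → 0# < x * y → 0# < y
  0<-cancelˡ {x} {y} p q with compare 0# y
  ... | tri< r _ _ = r
  ... | tri≈ _ r _ = ⊥-elim (0<⇒≉0 q (trans (*-congˡ (sym r)) (zeroʳ x)))
  ... | tri> _ _ r = ⊥-elim (0≤⇒≮0 (inj₁ q) (0<-⇒<0
          (<-respʳ-≈ (solve 2 (λ x y → x :* (:- y) := :- (x :* y)) refl x y)
            (*-pos p (<0⇒0<- r)))))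

  0≤-cancelˡ : ∀ {x y} → 0# < x → 0# ≤ x * y → 0# ≤ y
  0≤-cancelˡ {x} {y} p q = ≮0⇒0≤ λ r → 0≤⇒≮0 q (0<-⇒<0
    (<-respʳ-≈ (solve 2 (λ x y → x :* (:- y) := :- (x :* y)) refl x y)
      (*-pos p (<0⇒0<- r))))

  0<2 : 0# < 1# + 1#
  0<2 = 0<+0< 0<1 0<1

  ⁻¹-pos : ∀ {x} → 0# < x → 0# < x ⁻¹
  ⁻¹-pos {x} p =
    0<-cancelˡ p (<-respʳ-≈ (sym (⁻¹-inverseʳ x (0<⇒≉0 p))) 0<1)

  nat-pos : ∀ n → 0# < suc n · 1#
  nat-pos zero    = <-respʳ-≈ (sym (+-identityʳ _)) 0<1
  nat-pos (suc n) = 0<+0< 0<1 (nat-pos n)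

  nat-excess-pos : ∀ m {ε} → 0# ≤ 1# + - ε → 0# < suc (suc m) · 1# + - ε
  nat-excess-pos m {ε} p = <-respʳ-≈
    (solve 2 (λ n e → n :+ (:1 :+ :- e) := :1 :+ n :+ :- e) refl (suc m · 1#) ε)
    (0<+0≤ (nat-pos m) p)

  quadruple-neg : ∀ {x} → x < 0# → 0# < - ((x + x) + (x + x))
  quadruple-neg {x} p = <-respʳ-≈
    (solve 1 (λ x → (:- x :+ :- x) :+ (:- x :+ :- x) := :- ((x :+ x) :+ (x :+ x))) refl x)
    (0<+0< (0<+0< 0<-x 0<-x) (0<+0< 0<-x 0<-x))
    where
    0<-x = <0⇒0<- p

  *-≉0 : ∀ {x y} → ¬ (x ≈ 0#) → ¬ (y ≈ 0#) → ¬ (x * y ≈ 0#)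
  *-≉0 {x} {y} p q r = q (trans (sym (*-identityˡ y))
    (trans (*-congʳ (sym (trans (*-comm _ _) (⁻¹-inverseʳ x p))))
    (trans (*-assoc _ _ _) (trans (*-congˡ r) (zeroʳ _)))))

  ½ : ℝ
  ½ = (1# + 1#) ⁻¹

  2*½ : (1# + 1#) * ½ ≈ 1#
  2*½ = ⁻¹-inverseʳ _ (0<⇒≉0 0<2)

  σ : ℕ → ℝ
  σ zero    = 1#
  σ (suc n) = ½ * σ n

  σ-pos : ∀ n → 0# < σ n
  σ-pos zero    = 0<1
  σ-pos (suc n) = *-pos (⁻¹-pos 0<2) (σ-pos n)

  2^*σ : ∀ n → 2^ n * σ n ≈ 1#
  2^*σ zero    = *-identityˡ 1#
  2^*σ (suc n) = trans (solve 4 (λ t p h s → (t :* p) :* (h :* s) := (t :* h) :* (p :* s))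
    refl (1# + 1#) (2^ n) ½ (σ n)) (trans (*-cong 2*½ (2^*σ n)) (*-identityˡ 1#))

  2^-pos : ∀ n → 0# < 2^ n
  2^-pos zero    = 0<1
  2^-pos (suc n) = *-pos 0<2 (2^-pos n)

  -- The doubling of an element above half the supremum exceeds the supremum.
  2^-unbounded : ∀ {x} K → 0# < x → ¬ (∀ n → 2^ n * x ≤ K)
  2^-unbounded {x} K 0<x bound
    with complete (λ y → ∃[ n ] (2^ n * x ≈ y))
           (x , 0 , *-identityˡ x)
           (K , λ { (n , p) → 0≤-⇒≤ (0≤-resp (+-congˡ (-‿cong p)) (≤⇒0≤- (bound n))) })
  ... | l , upper , least with least {½ * l} ½l<l
    where
    0<l : 0# < l
    0<l = <-respʳ-≈ (solve 2 (λ x l → x :+ (l :+ :- x) := l) refl x l)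
            (0<+0≤ 0<x (≤⇒0≤- (upper (0 , *-identityˡ x))))
    ½l<l : ½ * l < l
    ½l<l = 0<-⇒< (<-respʳ-≈ (trans (solve 2 (λ h l → h :* l := (:2 :* h) :* l :+ :- (h :* l))
             refl ½ l) (+-congʳ (trans (*-congʳ 2*½) (*-identityˡ l))))
             (*-pos (⁻¹-pos 0<2) 0<l))
  ... | y , (n , p) , ½l<y = 0≤⇒≮0 (≤⇒0≤- (upper (suc n , refl))) (0<-⇒<0
    (<-respʳ-≈ (trans (*-congˡ (+-congʳ (sym p)))
      (trans (solve 4 (λ m x h l → :2 :* (m :* x :+ :- (h :* l)) := :- ((:2 :* h) :* l :+ :- ((:2 :* m) :* x)))
         refl (2^ n) x ½ l)
       (-‿cong (+-congʳ (trans (*-congʳ 2*½) (*-identityˡ l))))))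
      (*-pos 0<2 (<⇒0<- ½l<y))))

  ≯⇒≤ : ∀ {x y} → ¬ (y < x) → x ≤ y
  ≯⇒≤ {x} {y} p with compare x y
  ... | tri< q _ _ = inj₁ q
  ... | tri≈ _ q _ = inj₂ q
  ... | tri> _ _ q = ⊥-elim (p q)

  half : ∀ x → ∃[ h ] ((1# + 1#) * h ≈ x)
  half x = ½ * x , trans (sym (*-assoc _ _ _)) (trans (*-congʳ 2*½) (*-identityˡ x))

  half-pos : ∀ {h x} → (1# + 1#) * h ≈ x → 0# < x → 0# < h
  half-pos p 0<x = 0<-cancelˡ 0<2 (<-respʳ-≈ (sym p) 0<x)

  square-mono : ∀ {x y} → 0# ≤ x → x < y → x * x < y * y
  square-mono {x} {y} 0≤x x<y = 0<-⇒<
    (<-respʳ-≈ (solve 2 (λ x y → (y :+ :- x) :* ((y :+ :- x) :+ x :+ x) := y :* y :+ :- (x :* x)) refl x y)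
      (*-pos (<⇒0<- x<y) (0<+0≤ (0<+0≤ (<⇒0<- x<y) 0≤x) 0≤x)))

  sqrt-from-below : ∀ {x l} → x < 1# → 0# ≤ l → l ≤ 1# → l * l < x →
                    ∃[ h ] (0# < h × (l + h) * (l + h) ≤ x)
  sqrt-from-below {x} {l} x<1 0≤l l≤1 l²<x
    with half (x + - (l * l))
  ... | k , 2k≈δ with half k
  ... | h , 2h≈k = h , 0<h , 0≤-⇒≤ (0≤-resp
        (trans (solve 2 (λ l h → :2 :* (h :* (:1 :+ :- l)) :+ h :* (:1 :+ :- h) :+ h
                  := :2 :* (:2 :* h) :+ :- (:2 :* l :* h :+ h :* h)) refl l h)
        (trans (+-congʳ 4h≈δ)
        (solve 3 (λ x l h → x :+ :- (l :* l) :+ :- (:2 :* l :* h :+ h :* h)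
                  := x :+ :- ((l :+ h) :* (l :+ h))) refl x l h)))
        (0≤+0≤ (0≤+0≤ (0≤*0≤ (inj₁ 0<2) (0≤*0≤ (inj₁ 0<h) (≤⇒0≤- l≤1)))
                      (0≤*0≤ (inj₁ 0<h) 0≤1-h)) (inj₁ 0<h)))
      where
      4h≈δ : (1# + 1#) * ((1# + 1#) * h) ≈ x + - (l * l)
      4h≈δ = trans (*-congˡ 2h≈k) 2k≈δ
      0<h : 0# < h
      0<h = half-pos 2h≈k (half-pos 2k≈δ (<⇒0<- l²<x))
      0≤1-h : 0# ≤ 1# + - h
      0≤1-h = 0≤-cancelˡ (*-pos 0<2 0<2) (0≤-resp
        (sym (trans (solve 1 (λ h → :2 :* :2 :* (:1 :+ :- h) := :2 :* :2 :+ :- (:2 :* (:2 :* h))) refl h)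
          (trans (+-congˡ (-‿cong 4h≈δ))
          (solve 2 (λ x l → :2 :* :2 :+ :- (x :+ :- (l :* l)) := :2 :+ :1 :+ (:1 :+ :- x) :+ l :* l) refl x l))))
        (0≤+0≤ (inj₁ (0<+0< (0<+0< 0<2 0<1) (<⇒0<- x<1))) (0≤square l)))

  sqrt-from-above : ∀ {x l} → 0# < x → 0# ≤ l → l ≤ 1# → x < l * l →
                    ∃[ y ] (0# < y × y < l × x ≤ y * y)
  sqrt-from-above {x} {l} 0<x 0≤l l≤1 x<l²
    with half (l * l + - x)
  ... | h , 2h≈δ = l + - h
    , 0<-cancelˡ 0<2 (<-respʳ-≈
        (sym (trans (solve 2 (λ l h → :2 :* (l :+ :- h) := :2 :* l :+ :- (:2 :* h)) refl l h)
          (trans (+-congˡ (-‿cong 2h≈δ))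
          (solve 2 (λ x l → :2 :* l :+ :- (l :* l :+ :- x) := x :+ (l :+ l :* (:1 :+ :- l))) refl x l))))
        (0<+0≤ 0<x (0≤+0≤ 0≤l (0≤*0≤ 0≤l (≤⇒0≤- l≤1)))))
    , 0<-⇒< (<-respʳ-≈ (solve 2 (λ l h → h := l :+ :- (l :+ :- h)) refl l h) 0<h)
    , 0≤-⇒≤ (0≤-resp
        (trans (solve 2 (λ l h → :2 :* (h :* (:1 :+ :- l)) :+ h :* h
                  := (l :+ :- h) :* (l :+ :- h) :+ (:2 :* h :+ :- (l :* l))) refl l h)
        (+-congˡ (trans (+-congʳ 2h≈δ) (solve 2 (λ x l → l :* l :+ :- x :+ :- (l :* l) := :- x) refl x l))))
        (0≤+0≤ (0≤*0≤ (inj₁ 0<2) (0≤*0≤ (inj₁ 0<h) (≤⇒0≤- l≤1))) (0≤square h)))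
      where
      0<h : 0# < h
      0<h = half-pos 2h≈δ (<⇒0<- x<l²)

  square-of-supremum : ∀ {x l} → 0# < x → x < 1# → 0# ≤ l → l ≤ 1# →
    (∀ y → 0# ≤ y → y * y ≤ x → y ≤ l) → (∀ y → 0# ≤ y → y < l → y * y < x) →
    l * l ≈ x
  square-of-supremum {x} {l} 0<x x<1 0≤l l≤1 upper exceeds with compare (l * l) x
  ... | tri≈ _ p _ = p
  ... | tri< p _ _ =
    let h , 0<h , q = sqrt-from-below x<1 0≤l l≤1 p in
    ⊥-elim (≤⇒≯ (upper (l + h) (0≤+0≤ 0≤l (inj₁ 0<h)) q) (x<x+0< 0<h))
  ... | tri> _ _ p =
    let y , 0<y , y<l , x≤y² = sqrt-from-above 0<x 0≤l l≤1 p in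
    ⊥-elim (≤⇒≯ x≤y² (exceeds y (inj₁ 0<y) y<l))

  ≤∧≉⇒< : ∀ {x y} → x ≤ y → ¬ (x ≈ y) → x < y
  ≤∧≉⇒< (inj₁ p) _ = p
  ≤∧≉⇒< (inj₂ p) q = ⊥-elim (q p)

  sqrt : ∀ {x} → 0# < x → x < 1# → ∃[ r ] (0# < r × r < 1# × r * r ≈ x)
  sqrt {x} 0<x x<1 = l
    , ≤∧≉⇒< 0≤l (λ p → 0<⇒≉0 0<x (trans (sym l²≈x) (trans (*-congʳ (sym p)) (zeroˡ l))))
    , ≤∧≉⇒< l≤1 (λ p → irrefl (trans (sym l²≈x) (trans (*-cong p p) (*-identityˡ 1#))) x<1)
    , l²≈x
    where
    S : ℝ → Set
    S r = 0# ≤ r × r * r ≤ x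

    0∈S : S 0#
    0∈S = inj₂ refl , inj₁ (<-respˡ-≈ (sym (zeroˡ 0#)) 0<x)

    S≤1 : ∀ {r} → S r → r ≤ 1#
    S≤1 (_ , p) = ≯⇒≤ λ 1<r → ≤⇒≯ p
      (<-trans x<1 (<-respˡ-≈ (*-identityˡ 1#) (square-mono (inj₁ 0<1) 1<r)))

    supremum : ∃[ l ] IsSupremum S l
    supremum = complete S (0# , 0∈S) (1# , S≤1)

    l : ℝ
    l = proj₁ supremum

    0≤l : 0# ≤ l
    0≤l = proj₁ (proj₂ supremum) 0∈S

    exceeds : ∀ y → 0# ≤ y → y < l → y * y < x
    exceeds y 0≤y y<l with proj₂ (proj₂ supremum) y<l
    ... | r , (_ , inj₁ r²<x) , y<r = <-trans (square-mono 0≤y y<r) r²<x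
    ... | r , (_ , inj₂ r²≈x) , y<r = <-respʳ-≈ r²≈x (square-mono 0≤y y<r)

    l≤1 : l ≤ 1#
    l≤1 = ≯⇒≤ λ 1<l → irrefl refl
      (<-trans x<1 (<-respˡ-≈ (*-identityˡ 1#) (exceeds 1# (inj₁ 0<1) 1<l)))

    l²≈x : l * l ≈ x
    l²≈x = square-of-supremum 0<x x<1 0≤l l≤1
      (λ y 0≤y p → proj₁ (proj₂ supremum) (0≤y , p)) exceeds

  Bounded : (ℕ → ℝ) → Set
  Bounded d = ∃[ K ] (∀ n → 0# ≤ K + d n × 0# ≤ K + - d n)

  bounded-+ : ∀ {d e} → Bounded d → Bounded e → Bounded (λ n → d n + e n)
  bounded-+ {d} {e} (K , p) (L , q) = K + L , λ n →
      0≤-resp (solve 4 (λ K L d e → (K :+ d) :+ (L :+ e) := K :+ L :+ (d :+ e)) refl K L (d n) (e n))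
        (0≤+0≤ (proj₁ (p n)) (proj₁ (q n)))
    , 0≤-resp (solve 4 (λ K L d e → (K :+ :- d) :+ (L :+ :- e) := K :+ L :+ :- (d :+ e)) refl K L (d n) (e n))
        (0≤+0≤ (proj₂ (p n)) (proj₂ (q n)))

  bounded-* : ∀ {d e} → Bounded d → Bounded e → Bounded (λ n → d n * e n)
  bounded-* {d} {e} (K , p) (L , q) = K * L , λ n →
      0≤-cancelˡ 0<2 (0≤-resp (solve 4 (λ K L d e → (K :+ d) :* (L :+ e) :+ (K :+ :- d) :* (L :+ :- e)
          := :2 :* (K :* L :+ d :* e)) refl K L (d n) (e n))
        (0≤+0≤ (0≤*0≤ (proj₁ (p n)) (proj₁ (q n))) (0≤*0≤ (proj₂ (p n)) (proj₂ (q n)))))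
    , 0≤-cancelˡ 0<2 (0≤-resp (solve 4 (λ K L d e → (K :+ d) :* (L :+ :- e) :+ (K :+ :- d) :* (L :+ e)
          := :2 :* (K :* L :+ :- (d :* e))) refl K L (d n) (e n))
        (0≤+0≤ (0≤*0≤ (proj₁ (p n)) (proj₂ (q n))) (0≤*0≤ (proj₂ (p n)) (proj₁ (q n)))))

  bounded-const : ∀ x → Bounded (λ _ → x)
  bounded-const x = x * x + 1# , λ _ →
      0≤-cancelˡ 0<2 (0≤-resp (solve 1 (λ x → (x :+ :1) :* (x :+ :1) :+ (x :* x :+ :1)
          := :2 :* (x :* x :+ :1 :+ x)) refl x)
        (0≤+0≤ (0≤square (x + 1#)) (0≤+0≤ (0≤square x) (inj₁ 0<1))))
    , 0≤-cancelˡ 0<2 (0≤-resp (solve 1 (λ x → (x :+ :- :1) :* (x :+ :- :1) :+ (x :* x :+ :1)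
          := :2 :* (x :* x :+ :1 :+ :- x)) refl x)
        (0≤+0≤ (0≤square (x + - 1#)) (0≤+0≤ (0≤square x) (inj₁ 0<1))))

  0≤1-σ : ∀ n → 0# ≤ 1# + - σ n
  0≤1-σ zero    = inj₂ (sym (-‿inverseʳ 1#))
  0≤1-σ (suc n) = 0≤-resp
    (trans (solve 2 (λ h s → h :* (:1 :+ :- s) :+ h := :2 :* h :+ :- (h :* s)) refl ½ (σ n))
           (+-congʳ 2*½))
    (0≤+0≤ (0≤*0≤ (inj₁ (⁻¹-pos 0<2)) (0≤1-σ n)) (inj₁ (⁻¹-pos 0<2)))

  bounded-σ : Bounded σ
  bounded-σ = 1# , λ n → inj₁ (0<+0< 0<1 (σ-pos n)) , 0≤1-σ n

  infix 4 _⟶_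
  _⟶_ : (ℕ → ℝ) → ℝ → Set
  X ⟶ x = ∃[ d ] (Bounded d × ∀ n → X n ≈ x + σ n * d n)

  ⟶-resp : ∀ {X Y x y} → (∀ n → X n ≈ Y n) → x ≈ y → X ⟶ x → Y ⟶ y
  ⟶-resp p q (d , b , r) = d , b , λ n → trans (sym (p n)) (trans (r n) (+-congʳ q))

  ⟶-const : ∀ x → (λ _ → x) ⟶ x
  ⟶-const x = (λ _ → 0#) , bounded-const 0# ,
    λ n → sym (trans (+-congˡ (zeroʳ _)) (+-identityʳ x))

  ⟶-σ : σ ⟶ 0#
  ⟶-σ = (λ _ → 1#) , bounded-const 1# , λ n → sym (trans (+-identityˡ _) (*-identityʳ _))

  ⟶-+ : ∀ {X Y x y} → X ⟶ x → Y ⟶ y → (λ n → X n + Y n) ⟶ x + y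
  ⟶-+ {x = x} {y} (d , b , p) (e , c , q) = (λ n → d n + e n) , bounded-+ b c , λ n →
    trans (+-cong (p n) (q n)) (solve 5 (λ x y s d e →
      (x :+ s :* d) :+ (y :+ s :* e) := (x :+ y) :+ s :* (d :+ e)) refl x y (σ n) (d n) (e n))

  ⟶-* : ∀ {X Y x y} → X ⟶ x → Y ⟶ y → (λ n → X n * Y n) ⟶ x * y
  ⟶-* {x = x} {y} (d , b , p) (e , c , q) =
    (λ n → x * e n + y * d n + σ n * (d n * e n)) ,
    bounded-+ (bounded-+ (bounded-* (bounded-const x) c) (bounded-* (bounded-const y) b))
      (bounded-* bounded-σ (bounded-* b c)) ,
    λ n → trans (*-cong (p n) (q n)) (solve 5 (λ x y s d e →
      (x :+ s :* d) :* (y :+ s :* e) := x :* y :+ s :* (x :* e :+ y :* d :+ s :* (d :* e)))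
      refl x y (σ n) (d n) (e n))

  ⟶-neg : ∀ {X x} → X ⟶ x → (λ n → - X n) ⟶ - x
  ⟶-neg {X} {x} p = ⟶-resp (λ n → solve 1 (λ z → :- :1 :* z := :- z) refl (X n))
    (solve 1 (λ z → :- :1 :* z := :- z) refl x) (⟶-* (⟶-const (- 1#)) p)

  0≤-limit : ∀ {X x} → X ⟶ x → (∀ n → 0# ≤ X n) → 0# ≤ x
  0≤-limit {X} {x} (d , (K , b) , p) 0≤X = ≮0⇒0≤ λ x<0 →
    2^-unbounded K (<0⇒0<- x<0) λ n → 0≤-⇒≤ (0≤-resp
      (trans (+-congʳ (*-congˡ (p n)))
      (trans (solve 5 (λ t s x d K → t :* (x :+ s :* d) :+ (K :+ :- d)
                := (t :* s) :* d :+ (K :+ :- d) :+ :- (t :* :- x)) refl (2^ n) (σ n) x (d n) K)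
      (+-congʳ (trans (+-congʳ (trans (*-congʳ (2^*σ n)) (*-identityˡ (d n))))
        (solve 2 (λ d K → d :+ (K :+ :- d) := K) refl (d n) K)))))
      (0≤+0≤ (0≤*0≤ (inj₁ (2^-pos n)) (0≤X n)) (proj₂ (b n))))

module ComplexField (𝓡 : CompleteOrderedField) where
  open CompleteOrderedField 𝓡 using (ℝ; commutativeRing; _≤_)
  open CommutativeRing commutativeRing hiding (Carrier)
  open RingProperties ring using (-0#≈0#)
  open Complex 𝓡 using (ℂ; _+i_; re; im; _≈ᶜ_; fromℝ; complexRawRing)
  open OrderedField 𝓡
  open RawRing complexRawRing
    renaming (_+_ to _+ᶜ_; _*_ to _*ᶜ_; -_ to -ᶜ_; 0# to 0ᶜ; 1# to 1ᶜ)
    using ()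

  module _ where
    open IntegerSolver commutativeRing

    isCommutativeRingᶜ : IsCommutativeRing _≈ᶜ_ _+ᶜ_ _*ᶜ_ -ᶜ_ 0ᶜ 1ᶜ
    isCommutativeRingᶜ = record
      { isRing = record
        { +-isAbelianGroup = record
          { isGroup = record
            { isMonoid = record
              { isSemigroup = record
                { isMagma = record
                  { isEquivalence = record
                    { refl  = refl , refl
                    ; sym   = λ (p , q) → sym p , sym q
                    ; trans = λ (p , q) (p′ , q′) → trans p p′ , trans q q′
                    }
                  ; ∙-cong = λ (p , q) (p′ , q′) → +-cong p p′ , +-cong q q′
                  }
                ; assoc = λ u v w → +-assoc _ _ _ , +-assoc _ _ _
                }
              ; identity = (λ w → +-identityˡ _ , +-identityˡ _)
                         , (λ w → +-identityʳ _ , +-identityʳ _)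
              }
            ; inverse = (λ w → -‿inverseˡ _ , -‿inverseˡ _)
                      , (λ w → -‿inverseʳ _ , -‿inverseʳ _)
            ; ⁻¹-cong = λ (p , q) → -‿cong p , -‿cong q
            }
          ; comm = λ u v → +-comm _ _ , +-comm _ _
          }
        ; *-cong = λ (p , q) (p′ , q′) →
            +-cong (*-cong p p′) (-‿cong (*-cong q q′)) ,
            +-cong (*-cong p q′) (*-cong q p′)
        ; *-assoc = λ (a +i b) (c +i d) (e +i f) →
            solve 6 (λ a b c d e f →
              (a :* c :+ :- (b :* d)) :* e :+ :- ((a :* d :+ b :* c) :* f)
              := a :* (c :* e :+ :- (d :* f)) :+ :- (b :* (c :* f :+ d :* e)))
              refl a b c d e f ,
            solve 6 (λ a b c d e f →
              (a :* c :+ :- (b :* d)) :* f :+ (a :* d :+ b :* c) :* e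
              := a :* (c :* f :+ d :* e) :+ b :* (c :* e :+ :- (d :* f)))
              refl a b c d e f
        ; *-identity =
            (λ (a +i b) → solve 2 (λ a b → :1 :* a :+ :- (:0 :* b) := a) refl a b
                        , solve 2 (λ a b → :1 :* b :+ :0 :* a := b) refl a b) ,
            (λ (a +i b) → solve 2 (λ a b → a :* :1 :+ :- (b :* :0) := a) refl a b
                        , solve 2 (λ a b → a :* :0 :+ b :* :1 := b) refl a b)
        ; distrib =
            (λ (a +i b) (c +i d) (e +i f) →
              solve 6 (λ a b c d e f →
                a :* (c :+ e) :+ :- (b :* (d :+ f))
                := (a :* c :+ :- (b :* d)) :+ (a :* e :+ :- (b :* f)))
                refl a b c d e f ,
              solve 6 (λ a b c d e f →
                a :* (d :+ f) :+ b :* (c :+ e)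
                := (a :* d :+ b :* c) :+ (a :* f :+ b :* e))
                refl a b c d e f) ,
            (λ (a +i b) (c +i d) (e +i f) →
              solve 6 (λ a b c d e f →
                (c :+ e) :* a :+ :- ((d :+ f) :* b)
                := (c :* a :+ :- (d :* b)) :+ (e :* a :+ :- (f :* b)))
                refl a b c d e f ,
              solve 6 (λ a b c d e f →
                (c :+ e) :* b :+ (d :+ f) :* a
                := (c :* b :+ d :* a) :+ (e :* b :+ f :* a))
                refl a b c d e f)
        }
      ; *-comm = λ (a +i b) (c +i d) →
          solve 4 (λ a b c d → a :* c :+ :- (b :* d) := c :* a :+ :- (d :* b))
            refl a b c d ,
          solve 4 (λ a b c d → a :* d :+ b :* c := c :* b :+ d :* a) refl a b c d
      }

  complexRing : CommutativeRing 0ℓ 0ℓ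
  complexRing = record { isCommutativeRing = isCommutativeRingᶜ }

  module ℂR = CommutativeRing complexRing

  module _ where
    open IntegerSolver commutativeRing

    fromℝ-cong : ∀ {x y} → x ≈ y → fromℝ x ≈ᶜ fromℝ y
    fromℝ-cong p = p , refl

    fromℝ-+ : ∀ x y → fromℝ (x + y) ≈ᶜ fromℝ x +ᶜ fromℝ y
    fromℝ-+ x y = refl , sym (+-identityˡ 0#)

    fromℝ-* : ∀ x y → fromℝ (x * y) ≈ᶜ fromℝ x *ᶜ fromℝ y
    fromℝ-* x y = solve 2 (λ x y → x :* y := x :* y :+ :- (:0 :* :0)) refl x y
                , solve 2 (λ x y → :0 := x :* :0 :+ :0 :* y) refl x y

    fromℝ-neg : ∀ x → fromℝ (- x) ≈ᶜ -ᶜ fromℝ x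
    fromℝ-neg x = refl , sym -0#≈0#

    -- cross w z = Im (w z̄).
    cross : ℂ → ℂ → ℝ
    cross w z = im w * re z + - (re w * im z)

    normSq : ℂ → ℝ
    normSq w = re w * re w + im w * im w

    cross-cong : ∀ {w w′ z z′} → w ≈ᶜ w′ → z ≈ᶜ z′ → cross w z ≈ cross w′ z′
    cross-cong (p , q) (p′ , q′) =
      +-cong (*-cong q p′) (-‿cong (*-cong p q′))

    cross-zeroˡ : ∀ {w} z → w ≈ᶜ 0ᶜ → cross w z ≈ 0#
    cross-zeroˡ z (p , q) = trans (+-cong (*-congʳ q) (-‿cong (*-congʳ p)))
      (solve 2 (λ a b → :0 :* a :+ :- (:0 :* b) := :0) refl (re z) (im z))

    cross-zeroʳ : ∀ w → cross w 0ᶜ ≈ 0#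
    cross-zeroʳ (a +i b) = solve 2 (λ a b → b :* :0 :+ :- (a :* :0) := :0) refl a b

    cross-+ˡ : ∀ u v z → cross (u +ᶜ v) z ≈ cross u z + cross v z
    cross-+ˡ (a +i b) (c +i d) (e +i f) = solve 6 (λ a b c d e f →
      (b :+ d) :* e :+ :- ((a :+ c) :* f) := (b :* e :+ :- (a :* f)) :+ (d :* e :+ :- (c :* f)))
      refl a b c d e f

    cross-scaleˡ : ∀ x w z → cross (fromℝ x *ᶜ w) z ≈ x * cross w z
    cross-scaleˡ x (a +i b) (c +i d) = solve 5 (λ x a b c d →
      (x :* b :+ :0 :* a) :* c :+ :- ((x :* a :+ :- (:0 :* b)) :* d)
      := x :* (b :* c :+ :- (a :* d))) refl x a b c d

    cross-self : ∀ w → cross w w ≈ 0#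
    cross-self (a +i b) = solve 2 (λ a b → b :* a :+ :- (a :* b) := :0) refl a b

    cross-anti : ∀ w z → cross w z ≈ - cross z w
    cross-anti (a +i b) (c +i d) = solve 4 (λ a b c d →
      b :* c :+ :- (a :* d) := :- (d :* a :+ :- (c :* b))) refl a b c d

    cross-factor : ∀ b k t p q →
      cross (fromℝ k *ᶜ (t *ᶜ p)) (fromℝ b *ᶜ p +ᶜ fromℝ k *ᶜ (t *ᶜ q))
      ≈ b * k * im t * normSq p + k * k * normSq t * cross p q
    cross-factor b k (t +i t′) (p +i p′) (q +i q′) = solve 8 (λ b k t t′ p p′ q q′ →
      let x = t :* p :+ :- (t′ :* p′)
          y = t :* p′ :+ t′ :* p
          u = t :* q :+ :- (t′ :* q′)
          v = t :* q′ :+ t′ :* q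
      in (k :* y :+ :0 :* x) :* ((b :* p :+ :- (:0 :* p′)) :+ (k :* u :+ :- (:0 :* v)))
         :+ :- ((k :* x :+ :- (:0 :* y)) :* ((b :* p′ :+ :0 :* p) :+ (k :* v :+ :0 :* u)))
      := b :* k :* t′ :* (p :* p :+ p′ :* p′)
         :+ k :* k :* (t :* t :+ t′ :* t′) :* (p′ :* q :+ :- (p :* q′)))
      refl b k t t′ p p′ q q′

    0≤normSq : ∀ w → 0# ≤ normSq w
    0≤normSq w = 0≤+0≤ (0≤square (re w)) (0≤square (im w))

module ComplexSeries (𝓡 : CompleteOrderedField) where
  open CompleteOrderedField 𝓡 using (ℝ; commutativeRing; _<_; _≤_)
  open CommutativeRing commutativeRing hiding (Carrier)
  open RingProperties ring using (-0#≈0#)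
  open RawSemiringDefinitions (RawRing.rawSemiring rawRing)
    using () renaming (_×_ to _·_)
  open Complex 𝓡 using (ℂ; im; _≈ᶜ_; fromℝ; complexRawRing)
  open RawRing complexRawRing
    renaming (_+_ to _+ᶜ_; _*_ to _*ᶜ_; -_ to -ᶜ_; 1# to 1ᶜ)
    using ()
  open OrderedField 𝓡
  open ComplexField 𝓡
  open SeriesRing complexRing
  open Differential.Derivation seriesRing θ θ-cong θ-+ θ-*

  ι : ℝ → Series
  ι x = constant (fromℝ x)

  ι-coefficient : ∀ x f m → (ι x *ˢ f) m ≈ᶜ fromℝ x *ᶜ f m
  ι-coefficient x f m = constant-*ˢ (fromℝ x) f m

  ι-cong : ∀ {x y} → x ≈ y → ι x ≈ˢ ι y
  ι-cong p = constant-cong (fromℝ-cong p)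

  ι-+ : ∀ x y → ι (x + y) ≈ˢ ι x +ˢ ι y
  ι-+ x y = 𝓢.trans {ι (x + y)} {constant (fromℝ x +ᶜ fromℝ y)} {ι x +ˢ ι y}
    (constant-cong (fromℝ-+ x y)) (constant-+ (fromℝ x) (fromℝ y))

  ι-* : ∀ x y → ι (x * y) ≈ˢ ι x *ˢ ι y
  ι-* x y = 𝓢.trans {ι (x * y)} {constant (fromℝ x *ᶜ fromℝ y)} {ι x *ˢ ι y}
    (constant-cong (fromℝ-* x y)) (constant-* (fromℝ x) (fromℝ y))

  ι-neg : ∀ x → ι (- x) ≈ˢ -ˢ ι x
  ι-neg x = 𝓢.trans {ι (- x)} {constant (-ᶜ fromℝ x)} { -ˢ ι x}
    (constant-cong (fromℝ-neg x)) (constant-neg (fromℝ x))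

  nat-ℂ : ∀ n → SeriesRing.nat complexRing n ≈ᶜ fromℝ (n · 1#)
  nat-ℂ zero    = refl , refl
  nat-ℂ (suc n) = ℂR.trans (ℂR.+-congˡ {1ᶜ} (nat-ℂ n)) (ℂR.sym (fromℝ-+ 1# (n · 1#)))

  θ-coefficient : ∀ f m → θ f m ≈ᶜ fromℝ (m · 1#) *ᶜ f m
  θ-coefficient f m = ℂR.*-congʳ {f m} (nat-ℂ m)

  Z² : Series
  Z² = Z *ˢ Z

  θ-Z² : θ Z² ≈ˢ (1ˢ +ˢ 1ˢ) *ˢ Z²
  θ-Z² = θ-square {Z} θ-Z

  Z²-coefficient : ∀ f m → (Z² *ˢ f) m ≈ᶜ shift (shift f) m
  Z²-coefficient f m = ℂR.trans (*ˢ-assoc Z Z f m)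
    (ℂR.trans (Z-*ˢ (Z *ˢ f) m) (shift-cong {Z *ˢ f} {shift f} (Z-*ˢ f) m))

  W : Series → ℕ → ℝ
  W g m = cross (g m) (shift (shift g) m)

  W-cong : ∀ {f g} → f ≈ˢ g → ∀ m → W f m ≈ W g m
  W-cong {f} {g} p m =
    cross-cong (p m) (shift-cong {shift f} {shift g} (shift-cong {f} {g} p) m)

  open PowersOfTwo seriesRing

  Cosine : ℝ → Set
  Cosine κ = 0# < 1# + κ × 0# < 1# + - κ

  half-angle : ∀ {κ} → Cosine κ →
    ∃[ μ ] (Cosine μ × Cosine (- μ) × κ ≈ 1# + - ((1# + 1#) * (μ * μ)))
  half-angle {κ} (0<1+κ , 0<1-κ)
    with half (1# + κ) | half (1# + - κ)
  ... | c , 2c≈ | s , 2s≈ =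
    let μ , 0<μ , μ<1 , μ²≈s = sqrt 0<s s<1 in
    μ , (0<+0< 0<1 0<μ , <⇒0<- μ<1)
      , (<⇒0<- μ<1 , 0<+0< 0<1 (<-respʳ-≈ (solve 1 (λ m → m := :- (:- m)) refl μ) 0<μ))
      , trans (solve 1 (λ k → k := :1 :+ :- (:1 :+ :- k)) refl κ)
          (+-congˡ (-‿cong (trans (sym 2s≈) (*-congˡ (sym μ²≈s)))))
    where
    open IntegerSolver commutativeRing
    open IsStrictTotalOrder (CompleteOrderedField.isStrictTotalOrder 𝓡)
      using (<-respʳ-≈)
    0<s : 0# < s
    0<s = half-pos 2s≈ 0<1-κ
    s<1 : s < 1#
    s<1 = 0<-⇒< (half-pos
      (trans (solve 1 (λ s → :2 :* (:1 :+ :- s) := :2 :+ :- (:2 :* s)) refl s)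
        (trans (+-congˡ (-‿cong 2s≈)) (solve 1 (λ k → :2 :+ :- (:1 :+ :- k) := :1 :+ k) refl κ)))
      0<1+κ)

  ι-half-angle : ∀ {κ μ} → κ ≈ 1# + - ((1# + 1#) * (μ * μ)) →
    ι κ ≈ˢ 1ˢ +ˢ (-ˢ ((1ˢ +ˢ 1ˢ) *ˢ (ι μ *ˢ ι μ)))
  ι-half-angle {κ} {μ} p = 𝓢.trans {ι κ} {ι (1# + - r)} (ι-cong p)
    (𝓢.trans {ι (1# + - r)} {1ˢ +ˢ ι (- r)} (ι-+ 1# (- r))
    (𝓢.+-congˡ {1ˢ} {ι (- r)} (𝓢.trans {ι (- r)} { -ˢ ι r} (ι-neg r)
      (𝓢.-‿cong {ι r} (𝓢.trans {ι r} {ι (1# + 1#) *ˢ ι (μ * μ)} (ι-* (1# + 1#) (μ * μ))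
        (𝓢.*-cong {ι (1# + 1#)} {1ˢ +ˢ 1ˢ} {ι (μ * μ)} {ι μ *ˢ ι μ} (ι-+ 1# 1#) (ι-* μ μ)))))))
    where
    r = (1# + 1#) * (μ * μ)

  quadProduct-split : ∀ {K} → All Cosine K →
    ∃[ L ] (All Cosine L × ∀ a b →
      quadProduct (map ι K) (a *ˢ a) (b *ˢ b) ≈ˢ quadProduct (map ι L) a b)
  quadProduct-split [] = [] , [] , λ a b → 𝓢.refl {1ˢ}
  quadProduct-split {κ ∷ K} (c ∷ cs) =
    let L , ds , p = quadProduct-split cs
        μ , cμ , c-μ , q = half-angle c
    in μ ∷ - μ ∷ L , cμ ∷ c-μ ∷ ds , λ a b →
      𝓢.trans {quadProduct (map ι (κ ∷ K)) (a *ˢ a) (b *ˢ b)}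
              {(quad (ι μ) a b *ˢ quad (ι (- μ)) a b) *ˢ quadProduct (map ι L) a b}
              {quadProduct (map ι (μ ∷ - μ ∷ L)) a b}
        (𝓢.*-cong {quad (ι κ) (a *ˢ a) (b *ˢ b)} {quad (ι μ) a b *ˢ quad (ι (- μ)) a b}
          {quadProduct (map ι K) (a *ˢ a) (b *ˢ b)} {quadProduct (map ι L) a b}
          (quad-split {ι κ} {ι μ} {ι (- μ)} (ι-half-angle q) (ι-neg μ) a b) (p a b))
        (𝓢.*-assoc (quad (ι μ) a b) (quad (ι (- μ)) a b) (quadProduct (map ι L) a b))

  pow2-sum : ∀ n → ∃[ K ] (All Cosine K × ∀ a b →
    pow2 (suc n) a +ˢ pow2 (suc n) b ≈ˢ quadProduct (map ι K) a b)
  pow2-sum zero = 0# ∷ [] , cosine-0 ∷ [] , λ a b →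
    𝓢.trans {(a *ˢ a) +ˢ (b *ˢ b)} {quad (ι 0#) a b} {quadProduct (ι 0# ∷ []) a b}
      (quad-zero {ι 0#} (𝓢.refl {0ˢ}) a b)
      (𝓢.sym {quadProduct (ι 0# ∷ []) a b} {quad (ι 0#) a b} (𝓢.*-identityʳ (quad (ι 0#) a b)))
    where
    cosine-0 : Cosine 0#
    cosine-0 = 0<+0≤ 0<1 (inj₂ refl) , 0<+0≤ 0<1 (inj₂ (sym -0#≈0#))
  pow2-sum (suc n) =
    let K , cs , p = pow2-sum n
        L , ds , q = quadProduct-split cs
    in L , ds , λ a b →
      𝓢.trans {pow2 (suc (suc n)) a +ˢ pow2 (suc (suc n)) b}
              {quadProduct (map ι K) (a *ˢ a) (b *ˢ b)} {quadProduct (map ι L) a b}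
        (p (a *ˢ a) (b *ˢ b)) (q a b)

  module Factors (t : ℂ) where
    Y : Series
    Y = constant t *ˢ Z²

    θ-Y : θ Y ≈ˢ (1ˢ +ˢ 1ˢ) *ˢ Y
    θ-Y = θ-constant-*-double {constant t} {Z²} (θ-constant t) θ-Z²

    open LinearFactors ι (λ c → θ-constant (fromℝ c)) Y θ-Y public

    Nonneg : ℝ × ℝ → Set
    Nonneg (b , k) = 0# ≤ b × 0# ≤ k

    quadProduct-factors : ∀ {s X} → 0# ≤ s → X *ˢ X ≈ˢ ι s *ˢ Y →
      ∀ {K} → All Cosine K → ∃[ l ] (All Nonneg l ×
        quadProduct (map ι K) (1ˢ +ˢ X) (1ˢ +ˢ (-ˢ X)) ≈ˢ product l)
    quadProduct-factors 0≤s p [] = [] , [] , 𝓢.refl {1ˢ}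
    quadProduct-factors {s} {X} 0≤s p {κ ∷ K} ((0<1+κ , 0<1-κ) ∷ cs) =
      let l , nn , q = quadProduct-factors {s} {X} 0≤s p cs in
      (b , k) ∷ l ,
      (0≤*0≤ (inj₁ 0<2) (inj₁ 0<1+κ) ,
       0≤*0≤ (0≤*0≤ (inj₁ 0<2) (inj₁ 0<1-κ)) 0≤s) ∷ nn ,
      𝓢.*-cong {quad (ι κ) (1ˢ +ˢ X) (1ˢ +ˢ (-ˢ X))} {factor (b , k)}
        {quadProduct (map ι K) (1ˢ +ˢ X) (1ˢ +ˢ (-ˢ X))} {product l}
        (quad-1± {X} {ι s} {Y} {ι b} {ι k} (ι κ) p ι-b ι-k) q
      where
      b k : ℝ
      b = (1# + 1#) * (1# + κ)
      k = (1# + 1#) * (1# + - κ) * s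
      ι-b : ι b ≈ˢ (1ˢ +ˢ 1ˢ) *ˢ (1ˢ +ˢ ι κ)
      ι-b = 𝓢.trans {ι b} {ι (1# + 1#) *ˢ ι (1# + κ)} (ι-* (1# + 1#) (1# + κ))
        (𝓢.*-cong {ι (1# + 1#)} {1ˢ +ˢ 1ˢ} {ι (1# + κ)} {1ˢ +ˢ ι κ} (ι-+ 1# 1#) (ι-+ 1# κ))
      ι-k : ι k ≈ˢ ((1ˢ +ˢ 1ˢ) *ˢ (1ˢ +ˢ (-ˢ ι κ))) *ˢ ι s
      ι-k = 𝓢.trans {ι k} {ι ((1# + 1#) * (1# + - κ)) *ˢ ι s} (ι-* ((1# + 1#) * (1# + - κ)) s)
        (𝓢.*-congʳ {ι s} {ι ((1# + 1#) * (1# + - κ))} {(1ˢ +ˢ 1ˢ) *ˢ (1ˢ +ˢ (-ˢ ι κ))}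
          (𝓢.trans {ι ((1# + 1#) * (1# + - κ))} {ι (1# + 1#) *ˢ ι (1# + - κ)}
            (ι-* (1# + 1#) (1# + - κ))
            (𝓢.*-cong {ι (1# + 1#)} {1ˢ +ˢ 1ˢ} {ι (1# + - κ)} {1ˢ +ˢ (-ˢ ι κ)} (ι-+ 1# 1#)
              (𝓢.trans {ι (1# + - κ)} {1ˢ +ˢ ι (- κ)} (ι-+ 1# (- κ))
                (𝓢.+-congˡ {1ˢ} {ι (- κ)} (ι-neg κ))))))

    pow2-sum-factors : ∀ n {s X} → 0# ≤ s → X *ˢ X ≈ˢ ι s *ˢ Y →
      ∃[ l ] (All Nonneg l ×
        pow2 n (1ˢ +ˢ X) +ˢ pow2 n (1ˢ +ˢ (-ˢ X)) ≈ˢ product l)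
    pow2-sum-factors zero {X = X} _ _ =
      (1# + 1# , 0#) ∷ [] , (inj₁ 0<2 , inj₂ refl) ∷ [] ,
      sum-1± {ι (1# + 1#)} {ι 0#} X Y (ι-+ 1# 1#) (𝓢.refl {0ˢ})
    pow2-sum-factors (suc n) {s} {X} 0≤s p =
      let K , cs , q = pow2-sum n
          l , nn , r = quadProduct-factors {s} {X} 0≤s p cs
      in l , nn ,
        𝓢.trans {pow2 (suc n) (1ˢ +ˢ X) +ˢ pow2 (suc n) (1ˢ +ˢ (-ˢ X))}
          {quadProduct (map ι K) (1ˢ +ˢ X) (1ˢ +ˢ (-ˢ X))} {product l}
          (q (1ˢ +ˢ X) (1ˢ +ˢ (-ˢ X))) r

    pow2-difference-factors : ∀ n {s X} → 0# ≤ s → X *ˢ X ≈ˢ ι s *ˢ Y →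
      ∃[ l ] (All Nonneg l ×
        pow2 n (1ˢ +ˢ X) +ˢ (-ˢ pow2 n (1ˢ +ˢ (-ˢ X))) ≈ˢ (X +ˢ X) *ˢ product l)
    pow2-difference-factors zero {X = X} _ _ = [] , [] , difference-1± X
    pow2-difference-factors (suc n) {s} {X} 0≤s p =
      let l , nn , q = pow2-difference-factors n {s} {X} 0≤s p
          l′ , nn′ , q′ = pow2-sum-factors n {s} {X} 0≤s p
          A = 1ˢ +ˢ X
          B = 1ˢ +ˢ (-ˢ X)
      in l ++ l′ , All.++⁺ nn nn′ ,
        𝓢.trans {pow2 (suc n) A +ˢ (-ˢ pow2 (suc n) B)}
          {(pow2 n A +ˢ (-ˢ pow2 n B)) *ˢ (pow2 n A +ˢ pow2 n B)}
          {(X +ˢ X) *ˢ product (l ++ l′)}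
          (pow2-difference n A B)
        (𝓢.trans {(pow2 n A +ˢ (-ˢ pow2 n B)) *ˢ (pow2 n A +ˢ pow2 n B)}
          {((X +ˢ X) *ˢ product l) *ˢ product l′} {(X +ˢ X) *ˢ product (l ++ l′)}
          (𝓢.*-cong {pow2 n A +ˢ (-ˢ pow2 n B)} {(X +ˢ X) *ˢ product l}
            {pow2 n A +ˢ pow2 n B} {product l′} q q′)
        (𝓢.trans {((X +ˢ X) *ˢ product l) *ˢ product l′}
          {(X +ˢ X) *ˢ (product l *ˢ product l′)} {(X +ˢ X) *ˢ product (l ++ l′)}
          (𝓢.*-assoc (X +ˢ X) (product l) (product l′))
          (𝓢.*-congˡ {X +ˢ X} {product l *ˢ product l′} {product (l ++ l′)}
            (𝓢.sym {product (l ++ l′)} {product l *ˢ product l′} (product-++ l l′)))))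

  -- θ of the even part αz² + βz⁴ of the exponent.
  module Exponents (α β : ℝ) where
    evenPart : Series
    evenPart = (ι (α + α) *ˢ Z²) +ˢ (ι ((β + β) + (β + β)) *ˢ (Z² *ˢ Z²))

    evenPart-coefficient : ∀ f m → (evenPart *ˢ f) m
      ≈ᶜ fromℝ (α + α) *ᶜ shift (shift f) m
         +ᶜ fromℝ ((β + β) + (β + β)) *ᶜ shift (shift (shift (shift f))) m
    evenPart-coefficient f m = ℂR.trans
      (*ˢ-distribʳ f (ι (α + α) *ˢ Z²) (ι ((β + β) + (β + β)) *ˢ (Z² *ˢ Z²)) m)
      (ℂR.+-cong
        (ℂR.trans (*ˢ-assoc (ι (α + α)) Z² f m)
          (ℂR.trans (ι-coefficient (α + α) (Z² *ˢ f) m)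
            (ℂR.*-congˡ {fromℝ (α + α)} (Z²-coefficient f m))))
        (ℂR.trans (*ˢ-assoc (ι ((β + β) + (β + β))) (Z² *ˢ Z²) f m)
          (ℂR.trans (ι-coefficient ((β + β) + (β + β)) ((Z² *ˢ Z²) *ˢ f) m)
            (ℂR.*-congˡ {fromℝ ((β + β) + (β + β))}
              (ℂR.trans (*ˢ-assoc Z² Z² f m)
                (ℂR.trans (Z²-coefficient (Z² *ˢ f) m)
                  (shift-cong {shift (Z² *ˢ f)} {shift (shift (shift f))}
                    (shift-cong {Z² *ˢ f} {shift (shift f)} (Z²-coefficient f)) m)))))))

  module Positivity (α β : ℝ) (β<0 : β < 0#) (t : ℂ)
    (ε : ℝ) (0≤1-ε : 0# ≤ 1# + - ε) (h : Series)
    (θ-h : θ h ≈ˢ (ι ε +ˢ Exponents.evenPart α β) *ˢ h) where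

    open Exponents α β

    y : ℝ
    y = im t

    open Factors t

    Y-coefficient : ∀ f m → (Y *ˢ f) m ≈ᶜ t *ᶜ shift (shift f) m
    Y-coefficient f m = ℂR.trans (*ˢ-assoc (constant t) Z² f m)
      (ℂR.trans (constant-*ˢ t (Z² *ˢ f) m) (ℂR.*-congˡ {t} (Z²-coefficient f m)))

    factor-coefficient : ∀ b k f m → ((ι b *ˢ f) +ˢ (ι k *ˢ (Y *ˢ f))) m
      ≈ᶜ fromℝ b *ᶜ f m +ᶜ fromℝ k *ᶜ (t *ᶜ shift (shift f) m)
    factor-coefficient b k f m = ℂR.+-cong (ι-coefficient b f m)
      (ℂR.trans (ι-coefficient k (Y *ˢ f) m)
        (ℂR.*-congˡ {fromℝ k} (Y-coefficient f m)))

    PositiveAt : ℕ → Set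
    PositiveAt m = ∀ l → All Nonneg l → 0# ≤ y * W (product l *ˢ h) m

    cross-θproduct : ∀ m → PositiveAt m →
      ∀ pre l → All Nonneg pre → All Nonneg l →
      0# ≤ y * cross (((product pre *ˢ θproduct l) *ˢ h) (suc (suc m)))
                     (((product pre *ˢ product l) *ˢ h) m)
    cross-θproduct m ih pre [] _ _ = inj₂ (sym (trans
      (*-congˡ (cross-zeroˡ (((product pre *ˢ product []) *ˢ h) m)
        (ℂR.trans (*ˢ-congʳ {product pre *ˢ 0ˢ} {0ˢ} h (𝓢.zeroʳ (product pre)) (suc (suc m)))
          (zero-*ˢ {0ˢ} constant-0 h (suc (suc m))))))
      (zeroʳ y)))
    cross-θproduct m ih pre ((b , k) ∷ l) nn-pre ((0≤b , 0≤k) ∷ nn-l) = 0≤-resp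
      (trans (sym (distribˡ y _ _)) (*-congˡ (trans
        (+-cong
          (trans (+-cong cross-head cross-head) (sym (cross-+ˡ H H G)))
          (cross-cong {R} {R} ℂR.refl (ℂR.sym (factor-move (b , k) (product pre) (product l) h m))))
        (trans (sym (cross-+ˡ (H +ᶜ H) R G))
          (cross-cong (ℂR.sym (θproduct-∷ b k l (product pre) h (suc (suc m)))) ℂR.refl)))))
      (0≤+0≤ (0≤-resp (sym (distribˡ y c c)) (0≤+0≤ 0≤yc 0≤yc))
        (cross-θproduct m ih ((b , k) ∷ pre) l ((0≤b , 0≤k) ∷ nn-pre) nn-l))
      where
      f = (product pre *ˢ product l) *ˢ h
      G = ((product pre *ˢ product ((b , k) ∷ l)) *ˢ h) m
      H = (ι k *ˢ (Y *ˢ f)) (suc (suc m))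
      R = ((product ((b , k) ∷ pre) *ˢ θproduct l) *ˢ h) (suc (suc m))
      c = b * k * y * normSq (f m) + k * k * normSq t * W f m
      cross-head : c ≈ cross H G
      cross-head = trans (sym (cross-factor b k t (f m) (shift (shift f) m)))
        (cross-cong
          (ℂR.sym (ℂR.trans (ι-coefficient k (Y *ˢ f) (suc (suc m)))
            (ℂR.*-congˡ {fromℝ k} (Y-coefficient f (suc (suc m))))))
          (ℂR.sym (ℂR.trans (factor-expand b k (product pre) (product l) h m)
            (factor-coefficient b k f m))))
      W-f : 0# ≤ y * W f m
      W-f = 0≤-resp
        (*-congˡ (W-cong {product (pre ++ l) *ˢ h} {f}
          (*ˢ-congʳ {product (pre ++ l)} {product pre *ˢ product l} h (product-++ pre l)) m))
        (ih (pre ++ l) (All.++⁺ nn-pre nn-l))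
      0≤yc : 0# ≤ y * c
      0≤yc = 0≤-resp
        (solve 6 (λ y b k n N w → b :* k :* (y :* y) :* n :+ k :* k :* N :* (y :* w)
            := y :* (b :* k :* y :* n :+ k :* k :* N :* w))
          refl y b k (normSq (f m)) (normSq t) (W f m))
        (0≤+0≤ (0≤*0≤ (0≤*0≤ (0≤*0≤ 0≤b 0≤k) (0≤square y)) (0≤normSq (f m)))
               (0≤*0≤ (0≤*0≤ (0≤square k) (0≤normSq t)) W-f))
        where
        open IntegerSolver commutativeRing

    coefficient-equation : ∀ l m → let g = product l *ˢ h in
      fromℝ (suc (suc m) · 1#) *ᶜ g (suc (suc m))
      ≈ᶜ (θproduct l *ˢ h) (suc (suc m))
         +ᶜ (fromℝ ε *ᶜ g (suc (suc m))
             +ᶜ (fromℝ (α + α) *ᶜ g m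
                 +ᶜ fromℝ ((β + β) + (β + β)) *ᶜ shift (shift g) m))
    coefficient-equation l m = ℂR.trans
      (ℂR.sym (θ-coefficient g M))
      (ℂR.trans (θ-*-eigen {ι ε +ˢ evenPart} {h} θ-h (product l) M)
      (ℂR.+-cong
        (*ˢ-congʳ {θ (product l)} {θproduct l} h (θ-product l) M)
        (ℂR.trans (*ˢ-distribʳ g (ι ε) evenPart M)
          (ℂR.+-cong (ι-coefficient ε g M) (evenPart-coefficient g M)))))
      where
      M = suc (suc m)
      g = product l *ˢ h

    excess : ℕ → ℝ
    excess m = suc (suc m) · 1# + - ε

    cross-equation : ∀ l m → let g = product l *ˢ h in
      cross ((θproduct l *ˢ h) (suc (suc m))) (g m)
      ≈ excess m * W g (suc (suc m)) + ((β + β) + (β + β)) * W g m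
    cross-equation l m = trans
      (solve 4 (λ s e a b → s := (s :+ (e :+ (a :+ b))) :+ :- (e :+ (a :+ b))) refl
        (cross D G) (ε * w) ((α + α) * cross G G) (β₄ * cross V G))
      (trans (+-cong (sym equation) (-‿cong (+-congˡ (+-cong
          (trans (*-congˡ (cross-self G)) (zeroʳ _)) (*-congˡ (cross-anti V G))))))
        (solve 5 (λ n e w b v →
            n :* w :+ :- (e :* w :+ (:0 :+ b :* :- v)) := (n :+ :- e) :* w :+ b :* v) refl
          (suc (suc m) · 1#) ε w β₄ (cross G V)))
      where
      open IntegerSolver commutativeRing
      g = product l *ˢ h
      D = (θproduct l *ˢ h) (suc (suc m))
      G = g m
      V = shift (shift g) m
      β₄ = (β + β) + (β + β)
      w = cross (g (suc (suc m))) G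
      equation : (suc (suc m) · 1#) * w
        ≈ cross D G + (ε * w + ((α + α) * cross G G + β₄ * cross V G))
      equation = trans (sym (cross-scaleˡ (suc (suc m) · 1#) (g (suc (suc m))) G))
        (trans (cross-cong (coefficient-equation l m) ℂR.refl)
        (trans (cross-+ˡ D (fromℝ ε *ᶜ g (suc (suc m))
             +ᶜ (fromℝ (α + α) *ᶜ G +ᶜ fromℝ β₄ *ᶜ V)) G)
        (+-congˡ (trans (cross-+ˡ (fromℝ ε *ᶜ g (suc (suc m))) (fromℝ (α + α) *ᶜ G +ᶜ fromℝ β₄ *ᶜ V) G)
        (+-cong (cross-scaleˡ ε (g (suc (suc m))) G)
          (trans (cross-+ˡ (fromℝ (α + α) *ᶜ G) (fromℝ β₄ *ᶜ V) G)
          (+-cong (cross-scaleˡ (α + α) G G) (cross-scaleˡ β₄ V G))))))))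

    recursion-inequality : ∀ m → PositiveAt m → ∀ l → All Nonneg l →
      let g = product l *ˢ h in
      0# ≤ y * (excess m * W g (suc (suc m)) + ((β + β) + (β + β)) * W g m)
    recursion-inequality m ih l nn = 0≤-resp
      (*-congˡ (trans
        (cross-cong
          (*ˢ-congʳ {1ˢ *ˢ θproduct l} {θproduct l} h (*ˢ-identityˡ (θproduct l)) (suc (suc m)))
          (*ˢ-congʳ {1ˢ *ˢ product l} {product l} h (*ˢ-identityˡ (product l)) m))
        (cross-equation l m)))
      (cross-θproduct m ih [] l [] nn)

    positive : ∀ m → PositiveAt m
    positive zero          l nn = inj₂ (sym (trans (*-congˡ (cross-zeroʳ ((product l *ˢ h) 0))) (zeroʳ y)))
    positive (suc zero)    l nn = inj₂ (sym (trans (*-congˡ (cross-zeroʳ ((product l *ˢ h) 1))) (zeroʳ y)))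
    positive (suc (suc m)) l nn = 0≤-cancelˡ (nat-excess-pos m 0≤1-ε) (0≤-resp
      (solve 5 (λ y n w b v → y :* (n :* w :+ b :* v) :+ :- b :* (y :* v) := n :* (y :* w))
        refl y (excess m) (W g (suc (suc m))) ((β + β) + (β + β)) (W g m))
      (0≤+0≤ (recursion-inequality m (positive m) l nn)
        (0≤*0≤ (inj₁ (quadruple-neg β<0)) (positive m l nn))))
      where
      open IntegerSolver commutativeRing
      g = product l *ˢ h

module FiniteSums (R : CommutativeRing 0ℓ 0ℓ) where
  open CommutativeRing R
  open RawSemiringDefinitions (RawRing.rawSemiring rawRing) using (sum)

  sum-snoc : ∀ n (v : ℕ → Carrier) →
             sum {suc n} (λ i → v (toℕ i)) ≈ sum {n} (λ i → v (toℕ i)) + v n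
  sum-snoc zero    v = trans (+-identityʳ (v 0)) (sym (+-identityˡ (v 0)))
  sum-snoc (suc n) v = trans (+-congˡ (sum-snoc n (λ i → v (suc i))))
    (sym (+-assoc _ _ _))

module LinearCombinations (R : CommutativeRing 0ℓ 0ℓ) where
  open CommutativeRing R
  open IntegerSolver R

  combination-0 : ∀ x y z → 0# ≈ x * 0# + (y * 0# + z * 0#)
  combination-0 = solve 3 (λ x y z → :0 := x :* :0 :+ (y :* :0 :+ z :* :0)) refl

  combination-1 : ∀ x y z → x ≈ x * 1# + (y * 0# + z * 0#)
  combination-1 = solve 3 (λ x y z → x := x :* :1 :+ (y :* :0 :+ z :* :0)) refl

  combination-2 : ∀ x y z → y ≈ x * 0# + (y * 1# + z * 0#)
  combination-2 = solve 3 (λ x y z → y := x :* :0 :+ (y :* :1 :+ z :* :0)) refl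

  combination-3 : ∀ x y z → z ≈ x * 0# + (y * 0# + z * 1#)
  combination-3 = solve 3 (λ x y z → z := x :* :0 :+ (y :* :0 :+ z :* :1)) refl

module ExponentialSeries (𝓡 : CompleteOrderedField) where
  open CompleteOrderedField 𝓡 using (ℝ; commutativeRing; _⁻¹; ⁻¹-inverseʳ; _<_)
  open CommutativeRing commutativeRing hiding (Carrier)
  open RawSemiringDefinitions (RawRing.rawSemiring rawRing)
    using () renaming (_×_ to _·_)
  open Complex 𝓡
    using (_≈ᶜ_; fromℝ; complexRawRing; exp; exponent; 1/!)
  open RawRing complexRawRing
    renaming (_+_ to _+ᶜ_; _*_ to _*ᶜ_; 0# to 0ᶜ; 1# to 1ᶜ)
    using ()
  open OrderedField 𝓡
  open ComplexField 𝓡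
  open SeriesRing complexRing
  open Differential.Derivation seriesRing θ θ-cong θ-+ θ-*
  open ComplexSeries 𝓡
  open RawSemiringDefinitions (RawRing.rawSemiring seriesRawRing)
    using (_^_) renaming (_×_ to _·ˢ_)
  open RawSemiringDefinitions (RawRing.rawSemiring complexRawRing) using (sum)

  nat-ˢ : ∀ n → n ·ˢ 1ˢ ≈ˢ ι (n · 1#)
  nat-ˢ zero    = 𝓢.refl {0ˢ}
  nat-ˢ (suc n) = 𝓢.trans {1ˢ +ˢ (n ·ˢ 1ˢ)} {1ˢ +ˢ ι (n · 1#)} {ι (suc n · 1#)}
    (𝓢.+-congˡ {1ˢ} {n ·ˢ 1ˢ} {ι (n · 1#)} (nat-ˢ n))
    (𝓢.sym {ι (suc n · 1#)} {1ˢ +ˢ ι (n · 1#)} (ι-+ 1# (n · 1#)))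

  nat-! : ∀ n → 0# < (n !) · 1#
  nat-! n with n ! | ℕ.1≤n! n
  ... | suc k | _ = nat-pos k

  1/!-suc : ∀ n → (suc n · 1#) * ((suc n !) · 1#) ⁻¹ ≈ ((n !) · 1#) ⁻¹
  1/!-suc n = trans (sym (*-identityʳ _))
    (trans (*-congˡ (sym (⁻¹-inverseʳ b (0<⇒≉0 (nat-! n)))))
    (trans (solve 4 (λ a d b b′ → a :* d :* (b :* b′) := (a :* b) :* d :* b′) refl a (c ⁻¹) b (b ⁻¹))
    (trans (*-congʳ (trans (*-congʳ (sym (×1-homo-* (suc n) (n !))))
      (⁻¹-inverseʳ c (0<⇒≉0 (nat-! (suc n)))))) (*-identityˡ _))))
    where
    open IntegerSolver commutativeRing
    open SemiringMult (CommutativeRing.semiring commutativeRing) using (×1-homo-*)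
    a = suc n · 1#
    b = (n !) · 1#
    c = (suc n !) · 1#

  1/!ˢ-suc : ∀ n → (suc n ·ˢ 1ˢ) *ˢ constant (1/! (suc n)) ≈ˢ constant (1/! n)
  1/!ˢ-suc n = 𝓢.trans {(suc n ·ˢ 1ˢ) *ˢ ι d} {ι (suc n · 1#) *ˢ ι d} {constant (1/! n)}
    (𝓢.*-congʳ {ι d} {suc n ·ˢ 1ˢ} {ι (suc n · 1#)} (nat-ˢ (suc n)))
    (𝓢.trans {ι (suc n · 1#) *ˢ ι d} {ι ((suc n · 1#) * d)} {constant (1/! n)}
      (𝓢.sym {ι ((suc n · 1#) * d)} {ι (suc n · 1#) *ˢ ι d} (ι-* (suc n · 1#) d))
      (ι-cong (1/!-suc n)))
    where
    d = ((suc n !) · 1#) ⁻¹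

  ^-vanishes : ∀ {f} → f 0 ≈ᶜ 0ᶜ → ∀ n m → m ℕ.< n → (f ^ n) m ≈ᶜ 0ᶜ
  ^-vanishes {f} p (suc n) zero    _         = zero-product (f 0) ((f ^ n) 0) p
    where
    zero-product : ∀ u v → u ≈ᶜ 0ᶜ → (u *ᶜ v) +ᶜ 0ᶜ ≈ᶜ 0ᶜ
    zero-product u v q = ℂR.trans (ℂR.+-identityʳ (u *ᶜ v))
      (ℂR.trans (ℂR.*-congʳ {v} q) (ℂR.zeroˡ v))
  ^-vanishes {f} p (suc n) (suc m) (s≤s m<n) = ℂR.trans
    (ℂR.+-cong
      (ℂR.trans (ℂR.*-congʳ {(f ^ n) (suc m)} p) (ℂR.zeroˡ ((f ^ n) (suc m))))
      (ℂR.trans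
        (*ˢ-cong-≤ (tail f) {f ^ n} {0ˢ} m (λ i i≤m →
          ℂR.trans (^-vanishes {f} p n i (ℕ.≤-<-trans i≤m m<n)) (ℂR.sym (constant-0 i))))
        (ℂR.trans (𝓢.zeroʳ (tail f) m) (constant-0 m))))
    (ℂR.+-identityˡ 0ᶜ)

  module _ (f : Series) (f0≈0 : f 0 ≈ᶜ 0ᶜ) where
    open PartialExponentials (λ n → constant (1/! n)) (λ n → θ-constant (1/! n)) 1/!ˢ-suc f

    partialExp-sum : ∀ M m → partialExp M m
      ≈ᶜ sum {M} (λ n → 1/! (toℕ n) *ᶜ (f ^ toℕ n) m)
    partialExp-sum zero    m = constant-0 m
    partialExp-sum (suc M) m = ℂR.trans
      (ℂR.+-cong (partialExp-sum M m) (constant-*ˢ (1/! M) (f ^ M) m))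
      (ℂR.sym (FiniteSums.sum-snoc complexRing M (λ n → 1/! n *ᶜ (f ^ n) m)))

    partialExp-suc : ∀ M m → m ℕ.< M → partialExp (suc M) m ≈ᶜ partialExp M m
    partialExp-suc M m m<M = ℂR.trans
      (ℂR.+-congˡ {partialExp M m} (ℂR.trans (constant-*ˢ (1/! M) (f ^ M) m)
        (ℂR.trans (ℂR.*-congˡ {1/! M} (^-vanishes {f} f0≈0 M m m<M)) (ℂR.zeroʳ (1/! M)))))
      (ℂR.+-identityʳ (partialExp M m))

    partialExp-exp-+ : ∀ m k → partialExp (k ℕ.+ suc m) m ≈ᶜ exp f m
    partialExp-exp-+ m zero    = partialExp-sum (suc m) m
    partialExp-exp-+ m (suc k) = ℂR.trans
      (partialExp-suc (k ℕ.+ suc m) m (ℕ.m≤n+m (suc m) k)) (partialExp-exp-+ m k)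

    partialExp-exp : ∀ M m → m ℕ.< M → partialExp M m ≈ᶜ exp f m
    partialExp-exp M m m<M = ≡.subst (λ k → partialExp k m ≈ᶜ exp f m)
      (ℕ.m∸n+n≡m m<M) (partialExp-exp-+ m (M ℕ.∸ suc m))

    θ-exp : θ (exp f) ≈ˢ θ f *ˢ exp f
    θ-exp m = ℂR.trans
      (ℂR.*-congˡ {SeriesRing.nat complexRing m}
        (ℂR.sym (partialExp-exp (suc (suc m)) m (ℕ.m<n⇒m<1+n (ℕ.n<1+n m)))))
      (ℂR.trans (θ-partialExp (suc m) m)
        (*ˢ-cong-≤ (θ f) {partialExp (suc m)} {exp f} m
          (λ i i≤m → partialExp-exp (suc m) i (s≤s i≤m))))

    exp-0 : exp f 0 ≈ᶜ 1ᶜ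
    exp-0 = ℂR.trans (ℂR.+-identityʳ (1/! 0 *ᶜ 1ᶜ)) (ℂR.trans (ℂR.*-identityʳ (1/! 0))
      (fromℝ-cong (trans (sym (*-identityˡ _))
        (trans (*-congʳ (sym (+-identityʳ 1#))) (⁻¹-inverseʳ _ (0<⇒≉0 (nat-! 0)))))))

  module _ (α β c : ℝ) where
    open Exponents α β

    exponent-series : ∀ s → exponent α β c s ≈ˢ
      (constant (fromℝ c *ᶜ s) *ˢ Z) +ˢ ((ι α *ˢ Z²) +ˢ (ι β *ˢ (Z² *ˢ Z²)))
    exponent-series s m = ℂR.trans (pointwise m) (ℂR.sym (ℂR.+-cong
      (constant-*ˢ a Z m)
      (ℂR.+-cong
        (ℂR.trans (ι-coefficient α Z² m) (ℂR.*-congˡ {fromℝ α} (Z-*ˢ Z m)))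
        (ℂR.trans (ι-coefficient β (Z² *ˢ Z²) m) (ℂR.*-congˡ {fromℝ β}
          (ℂR.trans (Z²-coefficient Z² m)
            (shift-cong {shift Z²} {shift (shift Z)} (shift-cong {Z²} {shift Z} (Z-*ˢ Z)) m)))))))
      where
      a = fromℝ c *ᶜ s
      open LinearCombinations complexRing
      pointwise : ∀ m → exponent α β c s m ≈ᶜ
        a *ᶜ Z m +ᶜ (fromℝ α *ᶜ shift Z m +ᶜ fromℝ β *ᶜ shift (shift (shift Z)) m)
      pointwise 0 = combination-0 a (fromℝ α) (fromℝ β)
      pointwise 1 = combination-1 a (fromℝ α) (fromℝ β)
      pointwise 2 = combination-2 a (fromℝ α) (fromℝ β)
      pointwise 3 = combination-0 a (fromℝ α) (fromℝ β)
      pointwise 4 = combination-3 a (fromℝ α) (fromℝ β)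
      pointwise (suc (suc (suc (suc (suc m))))) = combination-0 a (fromℝ α) (fromℝ β)

    θ-exponent : ∀ s → θ (exponent α β c s) ≈ˢ (constant (fromℝ c *ᶜ s) *ˢ Z) +ˢ evenPart
    θ-exponent s = 𝓢.trans {θ (exponent α β c s)}
      {θ ((constant a *ˢ Z) +ˢ ((ι α *ˢ Z²) +ˢ (ι β *ˢ (Z² *ˢ Z²))))}
      {(constant a *ˢ Z) +ˢ evenPart}
      (θ-cong {exponent α β c s} {(constant a *ˢ Z) +ˢ ((ι α *ˢ Z²) +ˢ (ι β *ˢ (Z² *ˢ Z²)))}
        (exponent-series s))
      (𝓢.trans {θ ((constant a *ˢ Z) +ˢ ((ι α *ˢ Z²) +ˢ (ι β *ˢ (Z² *ˢ Z²))))}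
        {(constant a *ˢ Z) +ˢ (((ι α +ˢ ι α) *ˢ Z²)
          +ˢ (((ι β +ˢ ι β) +ˢ (ι β +ˢ ι β)) *ˢ (Z² *ˢ Z²)))}
        {(constant a *ˢ Z) +ˢ evenPart}
        (θ-quartic {constant a} {ι α} {ι β} {Z}
          (θ-constant a) (θ-constant (fromℝ α)) (θ-constant (fromℝ β)) θ-Z)
        (𝓢.+-congˡ {constant a *ˢ Z}
          {((ι α +ˢ ι α) *ˢ Z²) +ˢ (((ι β +ˢ ι β) +ˢ (ι β +ˢ ι β)) *ˢ (Z² *ˢ Z²))} {evenPart}
          (𝓢.+-cong {(ι α +ˢ ι α) *ˢ Z²} {ι (α + α) *ˢ Z²}
            {((ι β +ˢ ι β) +ˢ (ι β +ˢ ι β)) *ˢ (Z² *ˢ Z²)}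
            {ι ((β + β) + (β + β)) *ˢ (Z² *ˢ Z²)}
            (𝓢.*-congʳ {Z²} {ι α +ˢ ι α} {ι (α + α)}
              (𝓢.sym {ι (α + α)} {ι α +ˢ ι α} (ι-+ α α)))
            (𝓢.*-congʳ {Z² *ˢ Z²} {(ι β +ˢ ι β) +ˢ (ι β +ˢ ι β)} {ι ((β + β) + (β + β))}
              (𝓢.sym {ι ((β + β) + (β + β))} {(ι β +ˢ ι β) +ˢ (ι β +ˢ ι β)}
                (𝓢.trans {ι ((β + β) + (β + β))} {ι (β + β) +ˢ ι (β + β)}
                  {(ι β +ˢ ι β) +ˢ (ι β +ˢ ι β)}
                  (ι-+ (β + β) (β + β))
                  (𝓢.+-cong {ι (β + β)} {ι β +ˢ ι β} {ι (β + β)} {ι β +ˢ ι β}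
                    (ι-+ β β) (ι-+ β β))))))))
      where
      a = fromℝ c *ᶜ s

    θ-generating : ∀ s {a} → fromℝ c *ᶜ s ≈ᶜ a → let E = exp (exponent α β c s) in
      θ E ≈ˢ ((constant a *ˢ Z) *ˢ E) +ˢ (evenPart *ˢ E)
    θ-generating s {a} p = 𝓢.trans {θ E} {θ φ *ˢ E} {((constant a *ˢ Z) *ˢ E) +ˢ (evenPart *ˢ E)}
      (θ-exp φ (ℂR.refl {0ᶜ}))
      (𝓢.trans {θ φ *ˢ E} {((constant a *ˢ Z) +ˢ evenPart) *ˢ E}
        {((constant a *ˢ Z) *ˢ E) +ˢ (evenPart *ˢ E)}
        (𝓢.*-congʳ {E} {θ φ} {(constant a *ˢ Z) +ˢ evenPart}
          (𝓢.trans {θ φ} {(constant (fromℝ c *ᶜ s) *ˢ Z) +ˢ evenPart}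
            {(constant a *ˢ Z) +ˢ evenPart}
            (θ-exponent s)
            (𝓢.+-congʳ {evenPart} {constant (fromℝ c *ᶜ s) *ˢ Z} {constant a *ˢ Z}
              (𝓢.*-congʳ {Z} {constant (fromℝ c *ᶜ s)} {constant a} (constant-cong p)))))
        (𝓢.distribʳ E (constant a *ˢ Z) evenPart))
      where
      φ = exponent α β c s
      E = exp φ

module RingLemmas {c ℓ} (R : CommutativeRing c ℓ) where
  open CommutativeRing R hiding (zero)
  open IntegerSolver R

  solve-scaled : ∀ {n i x v} → i * n ≈ 1# → n * x ≈ v → x ≈ i * v
  solve-scaled {n} {i} {x} p q = trans (sym (*-identityˡ x))
    (trans (*-congʳ (sym p)) (trans (*-assoc i n x) (*-congˡ q)))

  solve-sum : ∀ {u v w} → u ≈ v + w → v ≈ u + - w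
  solve-sum {v = v} {w} p = trans (solve 2 (λ v w → v := v :+ w :+ :- w) refl v w) (+-congʳ (sym p))

  scaled-square : ∀ {c s t} z → c * c ≈ s * t → (c * z) * (c * z) ≈ s * (t * (z * z))
  scaled-square {c} {s} {t} z p = trans
    (solve 2 (λ c z → (c :* z) :* (c :* z) := (c :* c) :* (z :* z)) refl c z)
    (trans (*-congʳ p) (*-assoc s t (z * z)))

  *-interchange : ∀ s a → (s * a) * (s * a) ≈ (s * s) * (a * a)
  *-interchange = solve 2 (λ s a → (s :* a) :* (s :* a) := (s :* s) :* (a :* a)) refl

  zero-term : ∀ z l e → (0# * z) * e + l * e ≈ l * e
  zero-term = solve 3 (λ z l e → (:0 :* z) :* e :+ l :* e := l :* e) refl

  sign-cancel : ∀ s x → s * x ≈ - (- s) * x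
  sign-cancel = solve 2 (λ s x → s :* x := :- (:- s) :* x) refl

  sign-combine : ∀ i a x u p v q s →
    i * (- a * (s * x) + (u * (- s * p) + v * (- s * q)))
    ≈ - s * (i * (a * x + (u * p + v * q)))
  sign-combine = solve 8 (λ i a x u p v q s →
    i :* (:- a :* (s :* x) :+ (u :* (:- s :* p) :+ v :* (:- s :* q)))
    := :- s :* (i :* (a :* x :+ (u :* p :+ v :* q)))) refl

  literal : ℕ → Carrier
  literal zero          = 0#
  literal (suc zero)    = 1#
  literal (suc (suc n)) = literal (suc n) + 1#

  module InitialTerms {n₁ n₂ n₃ a u v e₀ e₁ e₂ e₃}
    (n₁≈ : n₁ ≈ 1#) (n₂≈ : n₂ ≈ 1# + 1#) (n₃≈ : n₃ ≈ (1# + 1#) + 1#) (e₀≈ : e₀ ≈ 1#)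
    (p₁ : n₁ * e₁ ≈ a * e₀ + (u * 0# + v * 0#))
    (p₂ : n₂ * e₂ ≈ a * e₁ + (u * e₀ + v * 0#))
    (p₃ : n₃ * e₃ ≈ a * e₂ + (u * e₁ + v * 0#)) where

    term₁ : e₁ ≈ a
    term₁ = trans (sym (*-identityˡ e₁)) (trans (*-congʳ (sym n₁≈)) (trans p₁
      (trans (+-congʳ (*-congˡ e₀≈))
        (solve 3 (λ a u v → a :* :1 :+ (u :* :0 :+ v :* :0) := a) refl a u v))))

    term₂ : (1# + 1#) * e₂ ≈ a * a + u
    term₂ = trans (*-congʳ (sym n₂≈)) (trans p₂
      (trans (+-cong (*-congˡ term₁) (+-congʳ (*-congˡ e₀≈)))
        (solve 3 (λ a u v → a :* a :+ (u :* :1 :+ v :* :0) := a :* a :+ u) refl a u v)))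

    term₃ : (1# + 1#) * (((1# + 1#) + 1#) * e₃) ≈ a * (a * a + u) + (1# + 1#) * (u * a)
    term₃ = trans (*-congˡ (trans (*-congʳ (sym n₃≈)) (trans p₃ (+-congˡ (+-congʳ (*-congˡ term₁))))))
      (trans (solve 4 (λ a e u v → :2 :* (a :* e :+ (u :* a :+ v :* :0)) := a :* (:2 :* e) :+ :2 :* (u :* a))
        refl a e₂ u v) (+-congʳ (*-congˡ term₂)))

  distrib-sum : ∀ {n x y p q} → n * x ≈ p → n * y ≈ q → n * (x + y) ≈ p + q
  distrib-sum r s = trans (distribˡ _ _ _) (+-cong r s)

  distrib-difference : ∀ {m n x y p q} → m * (n * x) ≈ p → m * (n * y) ≈ q →
                       m * (n * (x + - y)) ≈ p + - q
  distrib-difference {m} {n} {x} {y} r s = trans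
    (solve 4 (λ m n x y → m :* (n :* (x :+ :- y)) := m :* (n :* x) :+ :- (m :* (n :* y))) refl m n x y)
    (+-cong r (-‿cong s))

module Convergence (𝓡 : CompleteOrderedField) where
  open CompleteOrderedField 𝓡 using (ℝ; commutativeRing; _<_; _⁻¹; ⁻¹-inverseʳ)
  open CommutativeRing commutativeRing hiding (Carrier)
  open RawSemiringDefinitions (RawRing.rawSemiring rawRing)
    using () renaming (_×_ to _·_)
  open Complex 𝓡 using (ℂ; re; im; _≈ᶜ_; fromℝ; complexRawRing)
  open RawRing complexRawRing
    renaming (_+_ to _+ᶜ_; _*_ to _*ᶜ_; -_ to -ᶜ_; 0# to 0ᶜ; 1# to 1ᶜ)
    using ()
  open OrderedField 𝓡
  open ComplexField 𝓡
  open SeriesRing complexRing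
  open Differential.Derivation seriesRing θ θ-cong θ-+ θ-*
  open ComplexSeries 𝓡
  open PowersOfTwo seriesRing using (pow2; pow2-1; pow2-1+-*) renaming (2^ to 2^ˢ)
  open PowersOfTwo commutativeRing using (2^)

  infix 4 _⟶ᶜ_
  _⟶ᶜ_ : (ℕ → ℂ) → ℂ → Set
  X ⟶ᶜ x = (λ n → re (X n)) ⟶ re x × (λ n → im (X n)) ⟶ im x

  ⟶ᶜ-resp : ∀ {X Y x y} → (∀ n → X n ≈ᶜ Y n) → x ≈ᶜ y → X ⟶ᶜ x → Y ⟶ᶜ y
  ⟶ᶜ-resp p (q , q′) (r , r′) =
    ⟶-resp (λ n → proj₁ (p n)) q r , ⟶-resp (λ n → proj₂ (p n)) q′ r′

  ⟶ᶜ-const : ∀ x → (λ _ → x) ⟶ᶜ x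
  ⟶ᶜ-const x = ⟶-const (re x) , ⟶-const (im x)

  ⟶ᶜ-+ : ∀ {X Y x y} → X ⟶ᶜ x → Y ⟶ᶜ y → (λ n → X n +ᶜ Y n) ⟶ᶜ x +ᶜ y
  ⟶ᶜ-+ (p , p′) (q , q′) = ⟶-+ p q , ⟶-+ p′ q′

  ⟶ᶜ-neg : ∀ {X x} → X ⟶ᶜ x → (λ n → -ᶜ X n) ⟶ᶜ -ᶜ x
  ⟶ᶜ-neg (p , p′) = ⟶-neg p , ⟶-neg p′

  ⟶ᶜ-* : ∀ {X Y x y} → X ⟶ᶜ x → Y ⟶ᶜ y → (λ n → X n *ᶜ Y n) ⟶ᶜ x *ᶜ y
  ⟶ᶜ-* (p , p′) (q , q′) =
    ⟶-+ (⟶-* p q) (⟶-neg (⟶-* p′ q′)) , ⟶-+ (⟶-* p q′) (⟶-* p′ q)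

  ⟶-cross : ∀ {X Y x y} → X ⟶ᶜ x → Y ⟶ᶜ y → (λ n → cross (X n) (Y n)) ⟶ cross x y
  ⟶-cross (p , p′) (q , q′) = ⟶-+ (⟶-* p′ q) (⟶-neg (⟶-* p q′))

  ConvergesBelow : (ℕ → Series) → Series → ℕ → Set
  ConvergesBelow f g m = ∀ j → j ℕ.< m → (λ n → f n j) ⟶ᶜ g j

  shift-converges : ∀ {f g m} → ConvergesBelow f g m →
                    ConvergesBelow (λ n → shift (f n)) (shift g) (suc m)
  shift-converges p zero    _         = ⟶ᶜ-const 0ᶜ
  shift-converges p (suc j) (s≤s j<m) = p j j<m

  inv : ℕ → ℂ
  inv m = fromℝ ((suc m · 1#) ⁻¹)

  inv-* : ∀ m → inv m *ᶜ fromℝ (suc m · 1#) ≈ᶜ 1ᶜ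
  inv-* m = ℂR.trans (ℂR.sym (fromℝ-* _ _)) (fromℝ-cong
    (trans (*-comm _ _) (⁻¹-inverseʳ _ (0<⇒≉0 (nat-pos m)))))

  2^ˢ-ι : ∀ n → 2^ˢ n ≈ˢ ι (2^ n)
  2^ˢ-ι zero    = 𝓢.refl {1ˢ}
  2^ˢ-ι (suc n) = 𝓢.trans {(1ˢ +ˢ 1ˢ) *ˢ 2^ˢ n} {ι (1# + 1#) *ˢ ι (2^ n)} {ι (2^ (suc n))}
    (𝓢.*-cong {1ˢ +ˢ 1ˢ} {ι (1# + 1#)} {2^ˢ n} {ι (2^ n)}
      (𝓢.sym {ι (1# + 1#)} {1ˢ +ˢ 1ˢ} (ι-+ 1# 1#)) (2^ˢ-ι n))
    (𝓢.sym {ι (2^ (suc n))} {ι (1# + 1#) *ˢ ι (2^ n)} (ι-* (1# + 1#) (2^ n)))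

  pow2-constant-term : ∀ n f → f 0 ≈ᶜ 1ᶜ → pow2 n f 0 ≈ᶜ 1ᶜ
  pow2-constant-term zero    f p = p
  pow2-constant-term (suc n) f p = pow2-constant-term n (f *ˢ f)
    (ℂR.trans (ℂR.+-identityʳ (f 0 *ᶜ f 0)) (ℂR.trans (ℂR.*-cong p p) (ℂR.*-identityˡ 1ᶜ)))

  module _ (α β : ℝ) where
    open Exponents α β

    evenTerms : Series → ℕ → ℂ
    evenTerms f m = fromℝ (α + α) *ᶜ shift (shift f) m
      +ᶜ fromℝ ((β + β) + (β + β)) *ᶜ shift (shift (shift (shift f))) m

    monomial-coefficient : ∀ a f m → ((constant a *ˢ Z) *ˢ f) m ≈ᶜ a *ᶜ shift f m
    monomial-coefficient a f m = ℂR.trans (*ˢ-assoc (constant a) Z f m)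
      (ℂR.trans (constant-*ˢ a (Z *ˢ f) m) (ℂR.*-congˡ {a} (Z-*ˢ f m)))

    scaled-recurrence : ∀ {a f g} → θ f ≈ˢ ((constant a *ˢ Z) *ˢ g) +ˢ (evenPart *ˢ f) →
      ∀ m → fromℝ (m · 1#) *ᶜ f m ≈ᶜ a *ᶜ shift g m +ᶜ evenTerms f m
    scaled-recurrence {a} {f} {g} p m = ℂR.trans (ℂR.sym (θ-coefficient f m))
      (ℂR.trans (p m)
        (ℂR.+-cong (monomial-coefficient a g m) (evenPart-coefficient f m)))

    recurrence : ∀ {a f g} → θ f ≈ˢ ((constant a *ˢ Z) *ˢ g) +ˢ (evenPart *ˢ f) →
      ∀ m → f (suc m) ≈ᶜ inv m *ᶜ (a *ᶜ g m +ᶜ evenTerms f (suc m))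
    recurrence {a} {f} {g} p m = RingLemmas.solve-scaled complexRing
      {fromℝ (suc m · 1#)} {inv m} {f (suc m)}
      (inv-* m) (scaled-recurrence {a} {f} {g} p (suc m))

    evenTerms-converges : ∀ {f g} m → ConvergesBelow f g m →
                          (λ n → evenTerms (f n) m) ⟶ᶜ evenTerms g m
    evenTerms-converges {f} {g} m p = ⟶ᶜ-+
      (⟶ᶜ-* (⟶ᶜ-const (fromℝ (α + α)))
        (shift²-converges p m (ℕ.m<n⇒m<1+n (ℕ.n<1+n m))))
      (⟶ᶜ-* (⟶ᶜ-const (fromℝ ((β + β) + (β + β))))
        (shift²-converges (shift²-converges p) m
          (ℕ.m<n⇒m<1+n (ℕ.m<n⇒m<1+n (ℕ.m<n⇒m<1+n (ℕ.n<1+n m))))))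
      where
      shift²-converges : ∀ {f g m} → ConvergesBelow f g m →
        ConvergesBelow (λ n → shift (shift (f n))) (shift (shift g)) (suc (suc m))
      shift²-converges {f} {g} q = shift-converges {λ n → shift (f n)} {shift g}
        (shift-converges {f} {g} q)

    module _ (a : ℂ) (X : ℕ → Series)
      (X≈ : ∀ n → X n ≈ˢ constant (fromℝ (σ n) *ᶜ a) *ˢ Z)
      (e E : Series) (e0≈E0 : e 0 ≈ᶜ E 0)
      (θ-e : θ e ≈ˢ evenPart *ˢ e)
      (θ-E : θ E ≈ˢ ((constant a *ˢ Z) *ˢ E) +ˢ (evenPart *ˢ E)) where

      θ-X : ∀ n → θ (X n) ≈ˢ X n
      θ-X n = 𝓢.trans {θ (X n)} {θ (C *ˢ Z)} {X n} (θ-cong {X n} {C *ˢ Z} (X≈ n))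
        (𝓢.trans {θ (C *ˢ Z)} {C *ˢ θ Z} {X n}
          (θ-constant-* {C} (θ-constant (fromℝ (σ n) *ᶜ a)) Z)
          (𝓢.trans {C *ˢ θ Z} {C *ˢ Z} {X n} (𝓢.*-congˡ {C} {θ Z} {Z} θ-Z)
            (𝓢.sym {X n} {C *ˢ Z} (X≈ n))))
        where
        C = constant (fromℝ (σ n) *ᶜ a)

      2^*X : ∀ n → 2^ˢ n *ˢ X n ≈ˢ constant a *ˢ Z
      2^*X n = 𝓢.trans {2^ˢ n *ˢ X n} {ι (2^ n) *ˢ (C *ˢ Z)} {constant a *ˢ Z}
        (𝓢.*-cong {2^ˢ n} {ι (2^ n)} {X n} {C *ˢ Z} (2^ˢ-ι n) (X≈ n))
        (𝓢.trans {ι (2^ n) *ˢ (C *ˢ Z)} {(ι (2^ n) *ˢ C) *ˢ Z} {constant a *ˢ Z}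
          (𝓢.sym {(ι (2^ n) *ˢ C) *ˢ Z} {ι (2^ n) *ˢ (C *ˢ Z)} (𝓢.*-assoc (ι (2^ n)) C Z))
          (𝓢.*-congʳ {Z} {ι (2^ n) *ˢ C} {constant a}
            (𝓢.trans {ι (2^ n) *ˢ C} {constant (fromℝ (2^ n) *ᶜ (fromℝ (σ n) *ᶜ a))} {constant a}
              (𝓢.sym {constant (fromℝ (2^ n) *ᶜ (fromℝ (σ n) *ᶜ a))} {ι (2^ n) *ˢ C}
                (constant-* (fromℝ (2^ n)) (fromℝ (σ n) *ᶜ a)))
              (constant-cong (ℂR.trans (ℂR.sym (ℂR.*-assoc (fromℝ (2^ n)) (fromℝ (σ n)) a))
                (ℂR.trans (ℂR.*-congʳ {a} (ℂR.trans (ℂR.sym (fromℝ-* (2^ n) (σ n)))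
                  (fromℝ-cong (2^*σ n)))) (ℂR.*-identityˡ a)))))))
        where
        C = constant (fromℝ (σ n) *ᶜ a)

      approximation approximation⁻ : ℕ → Series
      approximation n  = pow2 n (1ˢ +ˢ X n) *ˢ e
      approximation⁻ n = pow2-1 n (1ˢ +ˢ X n) *ˢ e

      θ-approximation : ∀ n → θ (approximation n)
        ≈ˢ ((constant a *ˢ Z) *ˢ approximation⁻ n) +ˢ (evenPart *ˢ approximation n)
      θ-approximation n = θ-pow2-eigen n {1ˢ +ˢ X n} {X n} {constant a *ˢ Z} {e} {evenPart}
        (θ-1+ {X n} (θ-X n)) (2^*X n) θ-e

      approximation⁻-coefficient : ∀ n m → approximation⁻ n m
        ≈ᶜ approximation n m +ᶜ (-ᶜ ((fromℝ (σ n) *ᶜ a) *ᶜ shift (approximation⁻ n) m))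
      approximation⁻-coefficient n m = RingLemmas.solve-sum complexRing
        {approximation n m} {approximation⁻ n m}
        {(fromℝ (σ n) *ᶜ a) *ᶜ shift (approximation⁻ n) m}
        (ℂR.trans (pow2-1+-* n (X n) e m)
          (ℂR.+-congˡ {approximation⁻ n m}
            (ℂR.trans (*ˢ-congʳ {X n} {constant (fromℝ (σ n) *ᶜ a) *ˢ Z} (approximation⁻ n) (X≈ n) m)
              (monomial-coefficient (fromℝ (σ n) *ᶜ a) (approximation⁻ n) m))))

      approximation-0 : ∀ n → approximation n 0 ≈ᶜ E 0
      approximation-0 n = ℂR.trans (ℂR.+-identityʳ (pow2 n (1ˢ +ˢ X n) 0 *ᶜ e 0))
        (ℂR.trans (ℂR.*-congʳ {e 0} (pow2-constant-term n (1ˢ +ˢ X n) constant-term))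
          (ℂR.trans (ℂR.*-identityˡ (e 0)) e0≈E0))
        where
        constant-term : 1ᶜ +ᶜ X n 0 ≈ᶜ 1ᶜ
        constant-term = ℂR.trans (ℂR.+-congˡ {1ᶜ} (ℂR.trans (X≈ n 0)
          (ℂR.trans (constant-*ˢ (fromℝ (σ n) *ᶜ a) Z 0) (ℂR.zeroʳ (fromℝ (σ n) *ᶜ a)))))
          (ℂR.+-identityʳ 1ᶜ)

      Converges : ℕ → Set
      Converges m = (λ n → approximation n m) ⟶ᶜ E m × (λ n → approximation⁻ n m) ⟶ᶜ E m

      converges-step : ∀ m → (λ n → approximation n m) ⟶ᶜ E m →
        ConvergesBelow approximation⁻ E m → Converges m
      converges-step m p q = p , ⟶ᶜ-resp
        (λ n → ℂR.sym (approximation⁻-coefficient n m))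
        (ℂR.trans (ℂR.+-congˡ {E m} (ℂR.trans
            (ℂR.-‿cong (ℂR.trans (ℂR.*-congʳ {shift E m} (ℂR.zeroˡ a)) (ℂR.zeroˡ (shift E m))))
            (RingProperties.-0#≈0# ℂR.ring)))
          (ℂR.+-identityʳ (E m)))
        (⟶ᶜ-+ p (⟶ᶜ-neg (⟶ᶜ-* (⟶ᶜ-* (⟶-σ , ⟶-const 0#) (⟶ᶜ-const a))
          (shift-converges {approximation⁻} {E} q m (ℕ.n<1+n m)))))

      converges : ∀ m → Converges m
      converges = <-rec Converges λ
        { zero    _  → converges-step 0
            (⟶ᶜ-resp (λ n → ℂR.sym (approximation-0 n)) ℂR.refl (⟶ᶜ-const (E 0))) (λ j ())
        ; (suc m) ih → converges-step (suc m)
            (⟶ᶜ-resp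
              (λ n → ℂR.sym (recurrence {a} {approximation n} {approximation⁻ n} (θ-approximation n) m))
              (ℂR.sym (recurrence {a} {E} {E} θ-E m))
              (⟶ᶜ-* (⟶ᶜ-const (inv m)) (⟶ᶜ-+
                (⟶ᶜ-* (⟶ᶜ-const a) (proj₂ (ih (ℕ.n<1+n m))))
                (evenTerms-converges {approximation} {E} (suc m) (λ j j<m → proj₁ (ih j<m))))))
            (λ j j<m → proj₂ (ih j<m))
        }

module NonVanishing (𝓡 : CompleteOrderedField) where
  open CompleteOrderedField 𝓡 using (ℝ; commutativeRing; _<_; _≤_; *-pos; 1≉0)
  open CommutativeRing commutativeRing hiding (Carrier; zero)
  open RawSemiringDefinitions (RawRing.rawSemiring rawRing)
    using () renaming (_×_ to _·_)
  open Complex 𝓡 using (ℂ; _+i_; re; im; _≈ᶜ_; fromℝ; complexRawRing)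
  open RawRing complexRawRing
    renaming (_+_ to _+ᶜ_; _*_ to _*ᶜ_; -_ to -ᶜ_; 0# to 0ᶜ; 1# to 1ᶜ)
    using ()
  open OrderedField 𝓡
  open ComplexField 𝓡
  open SeriesRing complexRing
  open Differential.Derivation seriesRing θ θ-cong θ-+ θ-*
  open ComplexSeries 𝓡
  open Convergence 𝓡
  open PowersOfTwo seriesRing using (pow2; distrib-swap)
  open IsStrictTotalOrder (CompleteOrderedField.isStrictTotalOrder 𝓡)
    using (<-respʳ-≈)
  module Ringᶜ = RingLemmas complexRing
  module Ringˢ = RingLemmas seriesRing

  sign : ℕ → ℂ
  sign zero    = 1ᶜ
  sign (suc m) = -ᶜ sign m

  SignedBelow : Series → Series → ℕ → Set
  SignedBelow f g m = ∀ j → j ℕ.< m → f j ≈ᶜ sign j *ᶜ g j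

  shift²-signed : ∀ {f g m} → SignedBelow f g m →
                  SignedBelow (shift (shift f)) (shift (shift g)) (suc (suc m))
  shift²-signed p zero          _               = ℂR.sym (ℂR.zeroʳ 1ᶜ)
  shift²-signed p (suc zero)    _               = ℂR.sym (ℂR.zeroʳ (-ᶜ 1ᶜ))
  shift²-signed {g = g} p (suc (suc j)) (s≤s (s≤s j<m)) =
    ℂR.trans (p j j<m) (Ringᶜ.sign-cancel (sign j) (g j))

  W-limit : ∀ {g G} → (∀ m → (λ n → g n m) ⟶ᶜ G m) → ∀ m → (λ n → W (g n) m) ⟶ W G m
  W-limit {g} {G} p m = ⟶-cross (p m)
    (shift-converges {λ n → shift (g n)} {shift G} {suc m}
      (shift-converges {g} {G} {m} (λ j _ → p j)) m (ℕ.m<n⇒m<1+n (ℕ.n<1+n m)))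

  fromℝ-nat : ∀ n → fromℝ (n · 1#) ≈ᶜ Ringᶜ.literal n
  fromℝ-nat zero          = ℂR.refl {0ᶜ}
  fromℝ-nat (suc zero)    = fromℝ-cong (+-identityʳ 1#)
  fromℝ-nat (suc (suc n)) = ℂR.trans (fromℝ-+ 1# (suc n · 1#))
    (ℂR.trans (ℂR.+-comm 1ᶜ (fromℝ (suc n · 1#))) (ℂR.+-congʳ {1ᶜ} (fromℝ-nat (suc n))))

  module _ where
    open IntegerSolver commutativeRing

    cross-even-initial : ∀ a x →
      cross ((a *ᶜ a +ᶜ fromℝ x) +ᶜ ((-ᶜ a) *ᶜ (-ᶜ a) +ᶜ fromℝ x)) (1ᶜ +ᶜ 1ᶜ)
      ≈ (1# + 1#) * (1# + 1#) * im (a *ᶜ a)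
    cross-even-initial (p +i q) x = solve 3 (λ p q x →
      let r = (p :* p :+ :- (q :* q) :+ x) :+ ((:- p) :* (:- p) :+ :- ((:- q) :* (:- q)) :+ x)
          i = (p :* q :+ q :* p :+ :0) :+ ((:- p) :* (:- q) :+ (:- q) :* (:- p) :+ :0)
      in i :* (:1 :+ :1) :+ :- (r :* (:0 :+ :0)) := :2 :* :2 :* (p :* q :+ q :* p))
      refl p q x

    cross-odd-initial : ∀ a x → let u = fromℝ x in
      cross ((a *ᶜ (a *ᶜ a +ᶜ u) +ᶜ (1ᶜ +ᶜ 1ᶜ) *ᶜ (u *ᶜ a))
             +ᶜ (-ᶜ ((-ᶜ a) *ᶜ ((-ᶜ a) *ᶜ (-ᶜ a) +ᶜ u) +ᶜ (1ᶜ +ᶜ 1ᶜ) *ᶜ (u *ᶜ (-ᶜ a)))))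
            (a +ᶜ (-ᶜ (-ᶜ a)))
      ≈ (1# + 1#) * (1# + 1#) * (normSq a * im (a *ᶜ a))
    cross-odd-initial (p +i q) x = solve 3 (λ p q x →
      let cubicʳ = λ p q → let s = p :* p :+ :- (q :* q) :+ x
                               t = p :* q :+ q :* p :+ :0
                               v = x :* p :+ :- (:0 :* q)
                               w = x :* q :+ :0 :* p
                           in (p :* s :+ :- (q :* t)) :+ ((:1 :+ :1) :* v :+ :- ((:0 :+ :0) :* w))
          cubicⁱ = λ p q → let s = p :* p :+ :- (q :* q) :+ x
                               t = p :* q :+ q :* p :+ :0
                               v = x :* p :+ :- (:0 :* q)
                               w = x :* q :+ :0 :* p
                           in (p :* t :+ q :* s) :+ ((:1 :+ :1) :* w :+ (:0 :+ :0) :* v)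
          r = cubicʳ p q :+ :- cubicʳ (:- p) (:- q)
          i = cubicⁱ p q :+ :- cubicⁱ (:- p) (:- q)
      in i :* (p :+ :- (:- p)) :+ :- (r :* (q :+ :- (:- q)))
         := :2 :* :2 :* ((p :* p :+ q :* q) :* (p :* q :+ q :* p)))
      refl p q x

  module _ (α β : ℝ) (β<0 : β < 0#) (a : ℂ) (y≉0 : ¬ (im (a *ᶜ a) ≈ 0#))
    (e E E⁻ : Series)
    (e-0 : e 0 ≈ᶜ 1ᶜ) (E-0 : E 0 ≈ᶜ 1ᶜ) (E⁻-0 : E⁻ 0 ≈ᶜ 1ᶜ)
    (θ-e : θ e ≈ˢ Exponents.evenPart α β *ˢ e)
    (θ-E : θ E ≈ˢ ((constant a *ˢ Z) *ˢ E) +ˢ (Exponents.evenPart α β *ˢ E))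
    (θ-E⁻ : θ E⁻ ≈ˢ ((constant (-ᶜ a) *ˢ Z) *ˢ E⁻)
                    +ˢ (Exponents.evenPart α β *ˢ E⁻)) where

    open Exponents α β

    t : ℂ
    t = a *ᶜ a

    y : ℝ
    y = im t

    β₄ : ℝ
    β₄ = (β + β) + (β + β)

    open Factors t using (Y; product; pow2-sum-factors; pow2-difference-factors)

    E⁻-sign : ∀ m → E⁻ m ≈ᶜ sign m *ᶜ E m
    E⁻-sign = <-rec (λ m → E⁻ m ≈ᶜ sign m *ᶜ E m) λ
      { zero    _  → ℂR.trans E⁻-0 (ℂR.trans (ℂR.sym E-0) (ℂR.sym (ℂR.*-identityˡ (E 0))))
      ; (suc m) ih →
        let below : SignedBelow E⁻ E (suc m)
            below j j<m = ih j<m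
            below₂ = shift²-signed {E⁻} {E} {suc m} below
            below₄ = shift²-signed {shift (shift E⁻)} {shift (shift E)} {suc (suc (suc m))} below₂
        in ℂR.trans (recurrence α β { -ᶜ a} {E⁻} {E⁻} θ-E⁻ m)
          (ℂR.trans (ℂR.*-congˡ {inv m} (ℂR.+-cong (ℂR.*-congˡ { -ᶜ a} (ih (ℕ.n<1+n m)))
            (ℂR.+-cong
              (ℂR.*-congˡ {fromℝ (α + α)} (below₂ (suc m) (ℕ.m<n⇒m<1+n (ℕ.n<1+n (suc m)))))
              (ℂR.*-congˡ {fromℝ β₄} (below₄ (suc m)
                (ℕ.m<n⇒m<1+n (ℕ.m<n⇒m<1+n (ℕ.m<n⇒m<1+n (ℕ.n<1+n (suc m)))))))))) 
          (ℂR.trans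
            (Ringᶜ.sign-combine (inv m) a (E m) (fromℝ (α + α)) (shift (shift E) (suc m))
              (fromℝ β₄) (shift (shift (shift (shift E))) (suc m)) (sign m))
            (ℂR.*-congˡ {sign (suc m)} (ℂR.sym (recurrence α β {a} {E} {E} θ-E m)))))
      }

    X : ℕ → Series
    X n = constant (fromℝ (σ n) *ᶜ a) *ˢ Z

    -X≈ : ∀ n → (-ˢ X n) ≈ˢ constant (fromℝ (σ n) *ᶜ (-ᶜ a)) *ˢ Z
    -X≈ n = 𝓢.trans { -ˢ X n} {(-ˢ C) *ˢ Z} {constant (fromℝ (σ n) *ᶜ (-ᶜ a)) *ˢ Z}
      (RingProperties.-‿distribˡ-* 𝓢.ring C Z)
      (𝓢.*-congʳ {Z} { -ˢ C} {constant (fromℝ (σ n) *ᶜ (-ᶜ a))}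
        (𝓢.trans { -ˢ C} {constant (-ᶜ (fromℝ (σ n) *ᶜ a))} {constant (fromℝ (σ n) *ᶜ (-ᶜ a))}
          (𝓢.sym {constant (-ᶜ (fromℝ (σ n) *ᶜ a))} { -ˢ C} (constant-neg (fromℝ (σ n) *ᶜ a)))
          (constant-cong (RingProperties.-‿distribʳ-* ℂR.ring (fromℝ (σ n)) a))))
      where
      C = constant (fromℝ (σ n) *ᶜ a)

    X-square : ∀ n → X n *ˢ X n ≈ˢ ι (σ n * σ n) *ˢ Y
    X-square n = Ringˢ.scaled-square {C} {ι (σ n * σ n)} {constant t} Z
      (𝓢.trans {C *ˢ C} {constant ((fromℝ (σ n) *ᶜ a) *ᶜ (fromℝ (σ n) *ᶜ a))}
        {ι (σ n * σ n) *ˢ constant t}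
        (𝓢.sym {constant ((fromℝ (σ n) *ᶜ a) *ᶜ (fromℝ (σ n) *ᶜ a))} {C *ˢ C}
          (constant-* (fromℝ (σ n) *ᶜ a) (fromℝ (σ n) *ᶜ a)))
        (𝓢.trans {constant ((fromℝ (σ n) *ᶜ a) *ᶜ (fromℝ (σ n) *ᶜ a))}
          {constant (fromℝ (σ n * σ n) *ᶜ t)} {ι (σ n * σ n) *ˢ constant t}
          (constant-cong (ℂR.trans (Ringᶜ.*-interchange (fromℝ (σ n)) a)
            (ℂR.*-congʳ {t} (ℂR.sym (fromℝ-* (σ n) (σ n))))))
          (constant-* (fromℝ (σ n * σ n)) t)))
      where
      C = constant (fromℝ (σ n) *ᶜ a)

    θ-increment : ∀ n → θ (X n) ≈ˢ X n
    θ-increment n = θ-X α β a X (λ n → 𝓢.refl {X n}) e E (ℂR.trans e-0 (ℂR.sym E-0)) θ-e θ-E n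

    plus minus : ℕ → Series
    plus n  = pow2 n (1ˢ +ˢ X n) *ˢ e
    minus n = pow2 n (1ˢ +ˢ (-ˢ X n)) *ˢ e

    plus-converges : ∀ m → (λ n → plus n m) ⟶ᶜ E m
    plus-converges m = proj₁ (converges α β a X (λ n → 𝓢.refl {X n}) e E
      (ℂR.trans e-0 (ℂR.sym E-0)) θ-e θ-E m)

    minus-converges : ∀ m → (λ n → minus n m) ⟶ᶜ E⁻ m
    minus-converges m = proj₁ (converges α β (-ᶜ a) (λ n → -ˢ X n) -X≈ e E⁻
      (ℂR.trans e-0 (ℂR.sym E⁻-0)) θ-e θ-E⁻ m)

    G H : Series
    G = E +ˢ E⁻
    H = E +ˢ (-ˢ E⁻)

    RecursionInequality : ℝ → Series → Set
    RecursionInequality ε g = ∀ m → 0# ≤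
      y * ((suc (suc m) · 1# + - ε) * W g (suc (suc m)) + β₄ * W g m)

    inequality-cong : ∀ {ε f g} → f ≈ˢ g → RecursionInequality ε f → RecursionInequality ε g
    inequality-cong {ε} {f} {g} p q m = 0≤-resp
      (*-congˡ (+-cong (*-congˡ (W-cong {f} {g} p (suc (suc m)))) (*-congˡ (W-cong {f} {g} p m)))) (q m)

    inequality-limit : ∀ {ε g f} → (∀ m → (λ n → g n m) ⟶ᶜ f m) →
      (∀ n → RecursionInequality ε (g n)) → RecursionInequality ε f
    inequality-limit {ε} {g} {f} p q m = 0≤-limit
      (⟶-* (⟶-const y) (⟶-+
        (⟶-* (⟶-const (suc (suc m) · 1# + - ε)) (W-limit {g} {f} p (suc (suc m))))
        (⟶-* (⟶-const β₄) (W-limit {g} {f} p m))))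
      (λ n → q n m)

    G-inequality : RecursionInequality 0# G
    G-inequality = inequality-limit {0#} {λ n → plus n +ˢ minus n} {G}
      (λ m → ⟶ᶜ-+ (plus-converges m) (minus-converges m)) factored
      where
      θ-e′ : θ e ≈ˢ (ι 0# +ˢ evenPart) *ˢ e
      θ-e′ = 𝓢.trans {θ e} {evenPart *ˢ e} {(ι 0# +ˢ evenPart) *ˢ e} θ-e
        (𝓢.*-congʳ {e} {evenPart} {0ˢ +ˢ evenPart}
          (𝓢.sym {0ˢ +ˢ evenPart} {evenPart} (𝓢.+-identityˡ evenPart)))
      open Positivity α β β<0 t 0# (0≤-resp (sym (trans (+-congˡ (RingProperties.-0#≈0# ring)) (+-identityʳ 1#))) (inj₁ 0<1))
        e θ-e′ using (positive; recursion-inequality)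
      factored : ∀ n → RecursionInequality 0# (plus n +ˢ minus n)
      factored n =
        let l , nn , p = pow2-sum-factors n {σ n * σ n} {X n} (0≤square (σ n)) (X-square n)
            P = pow2 n (1ˢ +ˢ X n)
            M = pow2 n (1ˢ +ˢ (-ˢ X n))
        in inequality-cong {0#} {product l *ˢ e} {plus n +ˢ minus n}
          (𝓢.sym {plus n +ˢ minus n} {product l *ˢ e}
            (𝓢.trans {plus n +ˢ minus n} {(P +ˢ M) *ˢ e} {product l *ˢ e}
              (𝓢.sym {(P +ˢ M) *ˢ e} {plus n +ˢ minus n} (𝓢.distribʳ e P M))
              (𝓢.*-congʳ {e} {P +ˢ M} {product l} p)))
          (λ m → recursion-inequality m (positive m) l nn)

    H-inequality : RecursionInequality 1# H
    H-inequality = inequality-limit {1#} {λ n → plus n +ˢ (-ˢ minus n)} {H}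
      (λ m → ⟶ᶜ-+ (plus-converges m) (⟶ᶜ-neg (minus-converges m))) factored
      where
      factored : ∀ n → RecursionInequality 1# (plus n +ˢ (-ˢ minus n))
      factored n =
        let l , nn , p = pow2-difference-factors n {σ n * σ n} {X n} (0≤square (σ n)) (X-square n)
            P = pow2 n (1ˢ +ˢ X n)
            M = pow2 n (1ˢ +ˢ (-ˢ X n))
            XX = X n +ˢ X n
        in inequality-cong {1#} {product l *ˢ (XX *ˢ e)} {plus n +ˢ (-ˢ minus n)}
          (𝓢.sym {plus n +ˢ (-ˢ minus n)} {product l *ˢ (XX *ˢ e)}
            (𝓢.trans {plus n +ˢ (-ˢ minus n)} {(P +ˢ (-ˢ M)) *ˢ e} {product l *ˢ (XX *ˢ e)}
              (𝓢.trans {plus n +ˢ (-ˢ minus n)} {plus n +ˢ ((-ˢ M) *ˢ e)} {(P +ˢ (-ˢ M)) *ˢ e}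
                (𝓢.+-congˡ {plus n} { -ˢ minus n} {(-ˢ M) *ˢ e} (RingProperties.-‿distribˡ-* 𝓢.ring M e))
                (𝓢.sym {(P +ˢ (-ˢ M)) *ˢ e} {plus n +ˢ ((-ˢ M) *ˢ e)} (𝓢.distribʳ e P (-ˢ M))))
              (𝓢.trans {(P +ˢ (-ˢ M)) *ˢ e} {(XX *ˢ product l) *ˢ e} {product l *ˢ (XX *ˢ e)}
                (𝓢.*-congʳ {e} {P +ˢ (-ˢ M)} {XX *ˢ product l} p)
                (distrib-swap XX (product l) e))))
          (λ m → Positivity.recursion-inequality α β β<0 t 1# (inj₂ (sym (-‿inverseʳ 1#)))
            (XX *ˢ e) (θ-double-eigen {X n} {e} {evenPart} (θ-increment n) θ-e)
            m (Positivity.positive α β β<0 t 1# (inj₂ (sym (-‿inverseʳ 1#)))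
              (XX *ˢ e) (θ-double-eigen {X n} {e} {evenPart} (θ-increment n) θ-e) m) l nn)

    W-step : ∀ {ε g} → 0# ≤ 1# + - ε → RecursionInequality ε g →
             ∀ m → 0# < y * W g m → 0# < y * W g (suc (suc m))
    W-step {ε} {g} 0≤1-ε q m p = 0<-cancelˡ (nat-excess-pos m 0≤1-ε) (<-respʳ-≈
      (solve 5 (λ y n w b v → :- b :* (y :* v) :+ y :* (n :* w :+ b :* v) := n :* (y :* w))
        refl y (suc (suc m) · 1# + - ε) (W g (suc (suc m))) β₄ (W g m))
      (0<+0≤ (*-pos (quadruple-neg β<0) p) (q m)))
      where
      open IntegerSolver commutativeRing

    module TermsE = Ringᶜ.InitialTerms {fromℝ (1 · 1#)} {fromℝ (2 · 1#)} {fromℝ (3 · 1#)}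
      {a} {fromℝ (α + α)} {fromℝ β₄} {E 0} {E 1} {E 2} {E 3}
      (fromℝ-nat 1) (fromℝ-nat 2) (fromℝ-nat 3) E-0
      (scaled-recurrence α β {a} {E} {E} θ-E 1)
      (scaled-recurrence α β {a} {E} {E} θ-E 2)
      (scaled-recurrence α β {a} {E} {E} θ-E 3)

    module TermsE⁻ = Ringᶜ.InitialTerms {fromℝ (1 · 1#)} {fromℝ (2 · 1#)} {fromℝ (3 · 1#)}
      { -ᶜ a} {fromℝ (α + α)} {fromℝ β₄} {E⁻ 0} {E⁻ 1} {E⁻ 2} {E⁻ 3}
      (fromℝ-nat 1) (fromℝ-nat 2) (fromℝ-nat 3) E⁻-0
      (scaled-recurrence α β { -ᶜ a} {E⁻} {E⁻} θ-E⁻ 1)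
      (scaled-recurrence α β { -ᶜ a} {E⁻} {E⁻} θ-E⁻ 2)
      (scaled-recurrence α β { -ᶜ a} {E⁻} {E⁻} θ-E⁻ 3)

    0<y² : 0# < y * y
    0<y² = square-pos y≉0

    re-a≉0 : ¬ (re a ≈ 0#)
    re-a≉0 p = y≉0 (trans (+-cong (*-congʳ p) (*-congˡ p))
      (solve 1 (λ x → :0 :* x :+ x :* :0 := :0) refl (im a)))
      where
      open IntegerSolver commutativeRing

    2ᶜ : ℂ
    2ᶜ = 1ᶜ +ᶜ 1ᶜ

    2ᶜ≈ : 2ᶜ ≈ᶜ fromℝ (1# + 1#)
    2ᶜ≈ = ℂR.sym (fromℝ-+ 1# 1#)

    3ᶜ≈ : 2ᶜ +ᶜ 1ᶜ ≈ᶜ fromℝ ((1# + 1#) + 1#)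
    3ᶜ≈ = ℂR.trans (ℂR.+-congʳ {1ᶜ} 2ᶜ≈) (ℂR.sym (fromℝ-+ (1# + 1#) 1#))

    W-G-2 : 0# < y * W G 2
    W-G-2 = 0<-cancelˡ 0<2 (<-respʳ-≈
      (trans (solve 2 (λ y w → :2 :* :2 :* (y :* y) :+ y :* (w :+ :- (:2 :* :2 :* y)) := y :* w) refl y _)
      (trans (*-congˡ (trans (sym (cross-even-initial a (α + α)))
        (trans (cross-cong
          (ℂR.sym (ℂR.trans (ℂR.*-congʳ {G 2} (ℂR.sym 2ᶜ≈))
            (Ringᶜ.distrib-sum {2ᶜ} {E 2} {E⁻ 2} TermsE.term₂ TermsE⁻.term₂)))
          (ℂR.sym (ℂR.+-cong E-0 E⁻-0)))
        (cross-scaleˡ (1# + 1#) (G 2) (G 0)))))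
      (solve 2 (λ y w → y :* (:2 :* w) := :2 :* (y :* w)) refl y (W G 2))))
      (0<+0≤ (*-pos (*-pos 0<2 0<2) 0<y²)
        (inj₂ (sym (trans (*-congˡ (-‿inverseʳ _)) (zeroʳ y))))))
      where
      open IntegerSolver commutativeRing

    W-H-3 : 0# < y * W H 3
    W-H-3 = 0<-cancelˡ 0<3 (0<-cancelˡ 0<2 (<-respʳ-≈
      (trans (solve 2 (λ y n → :2 :* :2 :* (n :* (y :* y)) := y :* (:2 :* :2 :* (n :* y))) refl y (normSq a))
      (trans (*-congˡ (trans (sym (cross-odd-initial a (α + α)))
        (trans (cross-cong
          (ℂR.sym (ℂR.trans
            (ℂR.trans (ℂR.*-congʳ {fromℝ ((1# + 1#) + 1#) *ᶜ H 3} (ℂR.sym 2ᶜ≈))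
              (ℂR.*-congˡ {2ᶜ} (ℂR.*-congʳ {H 3} (ℂR.sym 3ᶜ≈))))
            (Ringᶜ.distrib-difference {2ᶜ} {2ᶜ +ᶜ 1ᶜ} {E 3} {E⁻ 3} TermsE.term₃ TermsE⁻.term₃)))
          (ℂR.sym (ℂR.+-cong TermsE.term₁ (ℂR.-‿cong TermsE⁻.term₁))))
        (trans (cross-scaleˡ (1# + 1#) (fromℝ ((1# + 1#) + 1#) *ᶜ H 3) (H 1))
          (*-congˡ (cross-scaleˡ ((1# + 1#) + 1#) (H 3) (H 1)))))))
      (solve 2 (λ y w → y :* (:2 :* ((:2 :+ :1) :* w)) := :2 :* ((:2 :+ :1) :* (y :* w)))
        refl y (W H 3))))
      (*-pos (*-pos 0<2 0<2) (*-pos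
        (0<+0≤ (square-pos re-a≉0) (0≤square (im a))) 0<y²))))
      where
      open IntegerSolver commutativeRing
      0<3 : 0# < (1# + 1#) + 1#
      0<3 = 0<+0< 0<2 0<1

    double : ℕ → ℕ
    double zero    = zero
    double (suc k) = suc (suc (double k))

    W-G-even : ∀ k → 0# < y * W G (double (suc k))
    W-G-even zero    = W-G-2
    W-G-even (suc k) = W-step {0#} {G}
      (0≤-resp (sym (trans (+-congˡ (RingProperties.-0#≈0# ring)) (+-identityʳ 1#))) (inj₁ 0<1))
      G-inequality (double (suc k)) (W-G-even k)

    W-H-odd : ∀ k → 0# < y * W H (suc (double (suc k)))
    W-H-odd zero    = W-H-3
    W-H-odd (suc k) = W-step {1#} {H} (inj₂ (sym (-‿inverseʳ 1#)))
      H-inequality (suc (double (suc k))) (W-H-odd k)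

    vanishing : ∀ m → E m ≈ᶜ 0ᶜ → E⁻ m ≈ᶜ 0ᶜ
    vanishing m p = ℂR.trans (E⁻-sign m)
      (ℂR.trans (ℂR.*-congˡ {sign m} p) (ℂR.zeroʳ (sign m)))

    W-vanishing : ∀ g m → g m ≈ᶜ 0ᶜ → ¬ (0# < y * W g m)
    W-vanishing g m p q = 0<⇒≉0 q
      (trans (*-congˡ (cross-zeroˡ (shift (shift g) m) p)) (zeroʳ y))

    even-or-odd : ∀ m → ∃[ k ] (m ≡.≡ double k ⊎ m ≡.≡ suc (double k))
    even-or-odd zero    = 0 , inj₁ ≡.refl
    even-or-odd (suc m) with even-or-odd m
    ... | k , inj₁ ≡.refl = k , inj₂ ≡.refl
    ... | k , inj₂ ≡.refl = suc k , inj₁ ≡.refl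

    nonvanishing-even : ∀ k → ¬ (E (double k) ≈ᶜ 0ᶜ)
    nonvanishing-even zero    p = 1≉0 (proj₁ (ℂR.trans (ℂR.sym E-0) p))
    nonvanishing-even (suc k) p = W-vanishing G (double (suc k))
      (ℂR.trans (ℂR.+-cong p (vanishing (double (suc k)) p)) (ℂR.+-identityˡ 0ᶜ))
      (W-G-even k)

    nonvanishing-odd : ∀ k → ¬ (E (suc (double k)) ≈ᶜ 0ᶜ)
    nonvanishing-odd zero    p = re-a≉0 (proj₁ (ℂR.trans (ℂR.sym TermsE.term₁) p))
    nonvanishing-odd (suc k) p = W-vanishing H (suc (double (suc k)))
      (ℂR.trans (ℂR.+-cong p (ℂR.-‿cong (vanishing (suc (double (suc k))) p)))
        (ℂR.-‿inverseʳ 0ᶜ))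
      (W-H-odd k)

    nonvanishing : ∀ m → ¬ (E m ≈ᶜ 0ᶜ)
    nonvanishing m with even-or-odd m
    ... | k , inj₁ ≡.refl = nonvanishing-even k
    ... | k , inj₂ ≡.refl = nonvanishing-odd k

module Zeros (𝓡 : CompleteOrderedField) where
  open CompleteOrderedField 𝓡 using (ℝ; commutativeRing; _<_)
  open CommutativeRing commutativeRing hiding (Carrier; zero)
  open Complex 𝓡
    using (ℂ; re; im; _≈ᶜ_; fromℝ; complexRawRing; exp; exponent; 1/!; Polynomial; eval; IsGeneratedBy;
           IsReal; IsPurelyImaginary)
  open RawRing complexRawRing
    renaming (_*_ to _*ᶜ_; -_ to -ᶜ_; 0# to 0ᶜ)
    using ()
  open OrderedField 𝓡
  open ComplexField 𝓡
  open SeriesRing complexRing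
  open ComplexSeries 𝓡
  open ExponentialSeries 𝓡
  open NonVanishing 𝓡
  open IsStrictTotalOrder (CompleteOrderedField.isStrictTotalOrder 𝓡) using (_≟_)

  off-axes : (α β c : ℝ) → β < 0# → ¬ (c ≈ 0#) →
    (P : ℕ → Polynomial) → IsGeneratedBy α β c P →
    (m : ℕ) (z : ℂ) → eval (P m) z ≈ᶜ 0ᶜ → ¬ (re z ≈ 0#) → ¬ (im z ≈ 0#) → ⊥
  off-axes α β c β<0 c≉0 P generated m z root re≉0 im≉0 =
    nonvanishing α β β<0 a im-a²≉0 e E E⁻
      (exp-0 (exponent α β c 0ᶜ) (ℂR.refl {0ᶜ})) (exp-0 (exponent α β c z) (ℂR.refl {0ᶜ}))
      (exp-0 (exponent α β c (-ᶜ z)) (ℂR.refl {0ᶜ}))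
      θ-e (θ-generating α β c z (ℂR.refl {a}))
      (θ-generating α β c (-ᶜ z) (ℂR.sym (RingProperties.-‿distribʳ-* ℂR.ring (fromℝ c) z)))
      m E-m≈0
    where
    a : ℂ
    a = fromℝ c *ᶜ z
    e E E⁻ : Series
    e  = exp (exponent α β c 0ᶜ)
    E  = exp (exponent α β c z)
    E⁻ = exp (exponent α β c (-ᶜ z))

    E-m≈0 : E m ≈ᶜ 0ᶜ
    E-m≈0 = ℂR.trans (ℂR.sym (generated z m))
      (ℂR.trans (ℂR.*-congˡ {1/! m} root) (ℂR.zeroʳ (1/! m)))

    open Exponents α β

    θ-e : θ e ≈ˢ evenPart *ˢ e
    θ-e = 𝓢.trans {θ e} {((0ˢ *ˢ Z) *ˢ e) +ˢ (evenPart *ˢ e)} {evenPart *ˢ e}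
      (θ-generating α β c 0ᶜ (ℂR.zeroʳ (fromℝ c)))
      (RingLemmas.zero-term seriesRing Z evenPart e)

    im-a² : im (a *ᶜ a) ≈ (1# + 1#) * ((c * c) * (re z * im z))
    im-a² = solve 3 (λ c p q →
      let r = c :* p :+ :- (:0 :* q)
          i = c :* q :+ :0 :* p
      in r :* i :+ i :* r := :2 :* ((c :* c) :* (p :* q))) refl c (re z) (im z)
      where
      open IntegerSolver commutativeRing

    im-a²≉0 : ¬ (im (a *ᶜ a) ≈ 0#)
    im-a²≉0 p = *-≉0 (0<⇒≉0 0<2) (*-≉0 (*-≉0 c≉0 c≉0) (*-≉0 re≉0 im≉0))
      (trans (sym im-a²) p)

  on-axes : (α β c : ℝ) → β < 0# → ¬ (c ≈ 0#) →
    (P : ℕ → Polynomial) → IsGeneratedBy α β c P →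
    (m : ℕ) (z : ℂ) → eval (P m) z ≈ᶜ 0ᶜ → IsReal z ⊎ IsPurelyImaginary z
  on-axes α β c β<0 c≉0 P generated m z root with im z ≟ 0# | re z ≟ 0#
  ... | yes p | _     = inj₁ p
  ... | no _  | yes p = inj₂ p
  ... | no q  | no p  =
    ⊥-elim (off-axes α β c β<0 c≉0 P generated m z root p q)

theorem1 : (𝓡 : CompleteOrderedField) →
    let open CompleteOrderedField 𝓡
        open Complex 𝓡
    in
    (α β c : ℝ) → β < 0# → ¬ (c ≈ 0#) →
    (P : ℕ → Polynomial) → IsGeneratedBy α β c P →
    (m : ℕ) (z : ℂ) → eval (P m) z ≈ᶜ 0ᶜ →
    IsReal z ⊎ IsPurelyImaginary z
theorem1 = Zeros.on-axes
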